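{- Let $n$ be a sufficiently large integer, let $0 < \varepsilon = \varepsilon(n) < 1$ and let $q$ be a positive integer. (i) If $q \geq (1+\varepsilon) n$, then Client has a strategy to ensure that $\mathcal{L}(n,q) \leq c\, \varepsilon^{ -2} \ln n$ holds, where $c$ is some absolute constant. (ii) If $q \leq (1-\varepsilon) n$, then Waiter has a strategy to ensure that $\mathcal{L}(n,q) \geq \min\{n, 2\varepsilon n - 2\}$.
   Context: The $(q:1)$ Waiter-Client game on $E(K_n)$ (for a positive integer $q$) is the following two-player perfect information game. In each round, Waiter offers Client exactly $q+1$ edges of the complete graph $K_n$ which have not been claimed before; Client chooses one of these edges, which he keeps, and the remaining $q$ edges are claimed by Waiter. If fewer than $q+1$ unclaimed edges remain, all of them are claimed by Waiter. The game ends when all edges of $K_n$ have been claimed. Client's graph is the graph with vertex set $V(K_n)$ whose edges are all the edges claimed by Client. $\mathcal{L}(n,q)$ denotes the order (number of vertices) of a largest connected component of Client's graph at the end of the $(q:1)$ Waiter-Client game on $E(K_n)$ when Client tries to minimize this quantity, Waiter tries to maximize it, and both follow optimal strategies. -}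

module Defs where

open import Data.Bool.Base using (true; false)
open import Data.Fin.Base as Fin using (Fin; zero; suc)
import Data.Fin.Properties as Fin
open import Data.Fin.Subset using (Subset; ⊤; ⊥; _∈_; _⊆_; _─_; ∣_∣; inside; outside)
open import Data.Fin.Subset.Properties
  using (_∈?_; _⊆?_; ∣⊥∣≡0; ∣⊤∣≡n; ∣p∣≤n; out⊆; s⊆s; p∩q≢∅⇒∣p─q∣<∣p∣; x∈p∩q⁺; ⊥⊆)
open import Data.Integer.Base as ℤ using (+_)
import Data.Integer.Properties as ℤ
open import Data.List.Base using (List; []; _∷_; _++_; map; filter; cartesianProduct; allFin; lookup; length)
open import Data.List.Extrema.Nat 
  using ( max; min; argmax; argmin; xs≤max; max≤v⁺; v≤min⁺; min≤⊤; min≤xs; argmax-sel; argmin-sel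
        ; f[⊥]≤f[argmax]; f[xs]≤f[argmax]; f[argmin]≤f[⊤]; f[argmin]≤f[xs])
open import Data.List.Membership.Propositional using () renaming (_∈_ to _∈ˡ_)
open import Data.List.Membership.Propositional.Properties
  using (∈-map⁺; ∈-map⁻; ∈-filter⁺; ∈-filter⁻; ∈-allFin; ∈-++⁺ˡ; ∈-++⁺ʳ)
open import Data.List.Properties using (map-cong-local)
open import Data.List.Relation.Unary.All as All using (All)
import Data.List.Relation.Unary.All.Properties as All
open import Data.List.Relation.Unary.Any using (here; there)
open import Data.Nat.Base as ℕ using (ℕ; zero; suc; z≤n; s≤s)
import Data.Nat.Properties as ℕ
open import Data.Product.Base using (∃; _×_; _,_; proj₁; proj₂)
open import Data.Rational.Base as ℚ using (ℚ; 0ℚ; 1ℚ; ½; _/_)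
  renaming (_+_ to _+ℚ_; _*_ to _*ℚ_; _-_ to _-ℚ_; _≤_ to _≤ℚ_; _<_ to _<ℚ_)
import Data.Rational.Properties as ℚ
open import Data.Rational.Solver using (module +-*-Solver)
open import Data.Rational.Unnormalised.Base as ℚᵘ using (mkℚᵘ; *≡*; *≤*)
import Data.Rational.Unnormalised.Properties as ℚᵘ
open import Data.Sum.Base using (_⊎_; inj₁; inj₂)
open import Data.Vec.Base as Vec using (tabulate)
open import Relation.Binary.Construct.Closure.Equivalence using (EqClosure)
open import Relation.Binary.Construct.Closure.ReflexiveTransitive using (ε; _◅_; _◅◅_)
import Relation.Binary.Construct.Closure.Equivalence as Eq
open import Relation.Binary.Construct.Closure.Symmetric using (fwd; bwd)
open import Relation.Binary.PropositionalEquality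
  using (_≡_; refl; sym; trans; cong; cong₂; subst; subst₂)
open import Relation.Nullary using (Dec; yes; no; does; contradiction)
open import Relation.Nullary.Decidable using (map′; _×-dec_; _⊎-dec_)
open import Relation.Unary using (Decidable)

fromℕℚ : ℕ → ℚ
fromℕℚ n = + n / 1

-- Both reciprocals send 0 to 0.
1/ℕ : ℕ → ℚ
1/ℕ zero    = 0ℚ
1/ℕ (suc a) = + 1 / suc a

recip : ℚ → ℚ
recip p with p ℚ.≟ 0ℚ
... | yes _  = 0ℚ
... | no p≢0 = ℚ.1/_ p {{ℚ.≢-nonZero p≢0}}

sum : (ℕ → ℚ) → ℕ → ℚ
sum f zero    = 0ℚ
sum f (suc l) = sum f l +ℚ f l

open +-*-Solver using (solve; _:+_; _:*_; _:-_; :-_; _:=_; con)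

toℚᵘ-/ : ∀ n d → ℚ.toℚᵘ (+ n / suc d) ℚᵘ.≃ mkℚᵘ (+ n) d
toℚᵘ-/ n d = ℚ.toℚᵘ-fromℚᵘ (mkℚᵘ (+ n) d)

fromℕℚ-+ : ∀ m n → fromℕℚ (m ℕ.+ n) ≡ fromℕℚ m +ℚ fromℕℚ n
fromℕℚ-+ m n = ℚ.toℚᵘ-injective (ℚᵘ.≃-trans (toℚᵘ-/ (m ℕ.+ n) 0)
  (ℚᵘ.≃-trans (*≡* (cong₂ ℤ._*_ (sym (cong₂ ℤ._+_ (ℤ.*-identityʳ (+ m)) (ℤ.*-identityʳ (+ n)))) refl))
  (ℚᵘ.≃-sym (ℚᵘ.≃-trans (ℚ.toℚᵘ-homo-+ (fromℕℚ m) (fromℕℚ n))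
     (ℚᵘ.+-cong (toℚᵘ-/ m 0) (toℚᵘ-/ n 0))))))

fromℕℚ-* : ∀ m n → fromℕℚ (m ℕ.* n) ≡ fromℕℚ m *ℚ fromℕℚ n
fromℕℚ-* m n = ℚ.toℚᵘ-injective (ℚᵘ.≃-trans (toℚᵘ-/ (m ℕ.* n) 0)
  (ℚᵘ.≃-trans (*≡* (cong₂ ℤ._*_ (ℤ.pos-* m n) refl))
  (ℚᵘ.≃-sym (ℚᵘ.≃-trans (ℚ.toℚᵘ-homo-* (fromℕℚ m) (fromℕℚ n))
     (ℚᵘ.*-cong (toℚᵘ-/ m 0) (toℚᵘ-/ n 0))))))

1/ℕ-inverse : ∀ a → fromℕℚ (suc a) *ℚ 1/ℕ (suc a) ≡ 1ℚ
1/ℕ-inverse a = ℚ.toℚᵘ-injective (ℚᵘ.≃-trans (ℚ.toℚᵘ-homo-* (fromℕℚ (suc a)) (1/ℕ (suc a)))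
  (ℚᵘ.≃-trans (ℚᵘ.*-cong (toℚᵘ-/ (suc a) 0) (toℚᵘ-/ 1 a))
    (*≡* (trans (ℤ.*-identityʳ _) (trans (ℤ.*-identityʳ _)
      (sym (trans (ℤ.*-identityˡ _) (cong +_ (cong suc (ℕ.+-identityʳ a))))))))))

1/ℕ-antitone : ∀ {a b} → a ℕ.≤ b → 1/ℕ (suc b) ≤ℚ 1/ℕ (suc a)
1/ℕ-antitone {a} {b} a≤b = ℚ.toℚᵘ-cancel-≤
  (ℚᵘ.≤-trans (ℚᵘ.≤-reflexive (toℚᵘ-/ 1 b))
  (ℚᵘ.≤-trans (*≤* (subst₂ ℤ._≤_ (sym (ℤ.*-identityˡ _)) (sym (ℤ.*-identityˡ _)) (ℤ.+≤+ (s≤s a≤b))))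
    (ℚᵘ.≤-reflexive (ℚᵘ.≃-sym (toℚᵘ-/ 1 a)))))

0≤1/ℕ : ∀ a → 0ℚ ≤ℚ 1/ℕ a
0≤1/ℕ zero    = ℚ.≤-refl
0≤1/ℕ (suc a) = ℚ.nonNegative⁻¹ _ {{ℚ.normalize-nonNeg 1 (suc a)}}

0≤fromℕℚ : ∀ a → 0ℚ ≤ℚ fromℕℚ a
0≤fromℕℚ a = ℚ.nonNegative⁻¹ _ {{ℚ.normalize-nonNeg a 1}}

archimedean : ∀ δ → 0ℚ <ℚ δ → ∃ λ N → 1/ℕ (suc N) ≤ℚ δ
archimedean δ@(ℚ.mkℚ (+ suc n) d _) 0<δ = d , ℚ.toℚᵘ-cancel-≤
  (ℚᵘ.≤-trans (ℚᵘ.≤-reflexive (toℚᵘ-/ 1 d))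
    (*≤* (ℤ.*-monoʳ-≤-nonNeg (+ suc d) {x = + 1} {y = + suc n} (ℤ.+≤+ (s≤s z≤n)))))
archimedean (ℚ.mkℚ (+ zero)   d _) (ℚ.*<* (ℤ.+<+ ()))
archimedean (ℚ.mkℚ (ℤ.-[1+ n ]) d _) (ℚ.*<* ())

recip-inverse : ∀ {p} → 0ℚ <ℚ p → p *ℚ recip p ≡ 1ℚ
recip-inverse {p} 0<p with p ℚ.≟ 0ℚ
... | yes refl = contradiction refl (ℚ.<⇒≢ 0<p)
... | no p≢0   = ℚ.*-inverseʳ p {{ℚ.≢-nonZero p≢0}}

recip-pos : ∀ {p} → 0ℚ <ℚ p → 0ℚ <ℚ recip p
recip-pos {p} 0<p with p ℚ.≟ 0ℚ
... | yes refl = contradiction refl (ℚ.<⇒≢ 0<p)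
... | no p≢0   = ℚ.positive⁻¹ _ {{ℚ.1/pos⇒pos p {{ℚ.positive 0<p}}}}

*-pos : ∀ {p q} → 0ℚ <ℚ p → 0ℚ <ℚ q → 0ℚ <ℚ p *ℚ q
*-pos {p} {q} 0<p 0<q = ℚ.positive⁻¹ _ {{ℚ.pos*pos⇒pos p {{ℚ.positive 0<p}} q {{ℚ.positive 0<q}}}}

*-mono : ∀ {p q r s} → 0ℚ ≤ℚ p → 0ℚ ≤ℚ s → p ≤ℚ q → r ≤ℚ s → p *ℚ r ≤ℚ q *ℚ s
*-mono {p} {q} {r} {s} 0≤p 0≤s p≤q r≤s = ℚ.≤-trans
  (ℚ.*-monoˡ-≤-nonNeg p {{ℚ.nonNegative 0≤p}} r≤s)
  (ℚ.*-monoʳ-≤-nonNeg s {{ℚ.nonNegative 0≤s}} p≤q)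

recip-antitone : ∀ {p q} → 0ℚ <ℚ p → p ≤ℚ q → recip q ≤ℚ recip p
recip-antitone {p} {q} 0<p p≤q = subst₂ _≤ℚ_ eq₁ eq₂
    (*-mono (ℚ.<⇒≤ 0<p) 0≤rr p≤q (ℚ.≤-refl {recip p *ℚ recip q}))
  where
  0<q = ℚ.<-≤-trans 0<p p≤q
  0≤rr = ℚ.<⇒≤ (*-pos (recip-pos 0<p) (recip-pos 0<q))
  eq₁ : p *ℚ (recip p *ℚ recip q) ≡ recip q
  eq₁ = trans (sym (ℚ.*-assoc p _ _)) (trans (cong (_*ℚ recip q) (recip-inverse 0<p)) (ℚ.*-identityˡ _))
  eq₂ : q *ℚ (recip p *ℚ recip q) ≡ recip p
  eq₂ = trans (solve 3 (λ a b c → a :* (b :* c) := b :* (a :* c)) refl q (recip p) (recip q))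
          (trans (cong (recip p *ℚ_) (recip-inverse 0<q)) (ℚ.*-identityʳ _))

∣∣≤ : ∀ {p δ} → p ≤ℚ δ → ℚ.- p ≤ℚ δ → ℚ.∣ p ∣ ≤ℚ δ
∣∣≤ {p} {δ} a b with ℚ.∣p∣≡p∨∣p∣≡-p p
... | inj₁ eq = subst (_≤ℚ δ) (sym eq) a
... | inj₂ eq = subst (_≤ℚ δ) (sym eq) b

≤∣∣ : ∀ p → p ≤ℚ ℚ.∣ p ∣
≤∣∣ p with ℚ.≤-total 0ℚ p
... | inj₁ 0≤p = ℚ.≤-reflexive (sym (ℚ.0≤p⇒∣p∣≡p 0≤p))
... | inj₂ p≤0 = ℚ.≤-trans p≤0 (ℚ.0≤∣p∣ p)

∣-∣-swap : ∀ p q → ℚ.∣ p -ℚ q ∣ ≡ ℚ.∣ q -ℚ p ∣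
∣-∣-swap p q = trans (cong ℚ.∣_∣ (solve 2 (λ a b → a :- b := :- (b :- a)) refl p q)) (ℚ.∣-p∣≡∣p∣ _)

half-pos : ∀ {δ} → 0ℚ <ℚ δ → 0ℚ <ℚ δ *ℚ ½
half-pos 0<δ = *-pos 0<δ (ℚ.positive⁻¹ ½)

half-sum : ∀ δ → δ *ℚ ½ +ℚ δ *ℚ ½ ≡ δ
half-sum δ = trans (sym (ℚ.*-distribˡ-+ δ ½ ½)) (ℚ.*-identityʳ δ)

-≤⇒≤+ : ∀ {p q r} → p -ℚ q ≤ℚ r → p ≤ℚ q +ℚ r
-≤⇒≤+ {p} {q} {r} le = subst (_≤ℚ q +ℚ r) (solve 2 (λ a b → b :+ (a :- b) := a) refl p q) (ℚ.+-monoʳ-≤ q le)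

≤+⇒-≤ : ∀ {p q r} → p ≤ℚ q +ℚ r → p -ℚ q ≤ℚ r
≤+⇒-≤ {p} {q} {r} le = subst (p -ℚ q ≤ℚ_) (solve 2 (λ a b → (b :+ a) :- b := a) refl r q) (ℚ.+-monoˡ-≤ (ℚ.- q) le)

⊓-lipschitz : ∀ a b c d {δ} → a ≤ℚ c +ℚ δ → b ≤ℚ d +ℚ δ → a ℚ.⊓ b ≤ℚ (c ℚ.⊓ d) +ℚ δ
⊓-lipschitz a b c d {δ} h k with ℚ.⊓-sel c d
... | inj₁ eq = subst (λ z → a ℚ.⊓ b ≤ℚ z +ℚ δ) (sym eq) (ℚ.≤-trans (ℚ.p⊓q≤p a b) h)
... | inj₂ eq = subst (λ z → a ℚ.⊓ b ≤ℚ z +ℚ δ) (sym eq) (ℚ.≤-trans (ℚ.p⊓q≤q a b) k)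

+-close : ∀ a b c d {δ} → ℚ.∣ a -ℚ b ∣ ≤ℚ δ *ℚ ½ → ℚ.∣ c -ℚ d ∣ ≤ℚ δ *ℚ ½ →
          ℚ.∣ (a +ℚ c) -ℚ (b +ℚ d) ∣ ≤ℚ δ
+-close a b c d {δ} h k = subst₂ _≤ℚ_
  (cong ℚ.∣_∣ (solve 4 (λ a b c d → (a :- b) :+ (c :- d) := (a :+ c) :- (b :+ d)) refl a b c d))
  (half-sum δ)
  (ℚ.≤-trans (ℚ.∣p+q∣≤∣p∣+∣q∣ (a -ℚ b) (c -ℚ d)) (ℚ.+-mono-≤ h k))

neg-close : ∀ a b {δ} → ℚ.∣ a -ℚ b ∣ ≤ℚ δ → ℚ.∣ (ℚ.- a) -ℚ (ℚ.- b) ∣ ≤ℚ δ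
neg-close a b {δ} h = subst (_≤ℚ δ)
  (trans (∣-∣-swap a b) (cong ℚ.∣_∣ (solve 2 (λ a b → b :- a := (:- a) :- (:- b)) refl a b))) h

cancel : ∀ {B} δ → 0ℚ <ℚ B → B *ℚ (δ *ℚ recip B) ≡ δ
cancel {B} δ 0<B = trans (solve 3 (λ a b c → a :* (b :* c) := b :* (a :* c)) refl B δ (recip B))
  (trans (cong (δ *ℚ_) (recip-inverse 0<B)) (ℚ.*-identityʳ δ))

*-bounded : ∀ a d {A δ} → 0ℚ <ℚ A → 0ℚ <ℚ δ → ℚ.∣ a ∣ ≤ℚ A → ℚ.∣ d ∣ ≤ℚ δ *ℚ recip A → ℚ.∣ a *ℚ d ∣ ≤ℚ δ
*-bounded a d {A} {δ} 0<A 0<δ h k = subst₂ _≤ℚ_ (sym (ℚ.∣p*q∣≡∣p∣*∣q∣ a d)) (cancel δ 0<A)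
  (*-mono (ℚ.0≤∣p∣ a) (ℚ.<⇒≤ (*-pos 0<δ (recip-pos 0<A))) h k)

*-close : ∀ a b c d {A D δ} → 0ℚ <ℚ A → 0ℚ <ℚ D → 0ℚ <ℚ δ → ℚ.∣ a ∣ ≤ℚ A → ℚ.∣ d ∣ ≤ℚ D →
          ℚ.∣ c -ℚ d ∣ ≤ℚ δ *ℚ ½ *ℚ recip A → ℚ.∣ a -ℚ b ∣ ≤ℚ δ *ℚ ½ *ℚ recip D →
          ℚ.∣ a *ℚ c -ℚ b *ℚ d ∣ ≤ℚ δ
*-close a b c d {δ = δ} 0<A 0<D 0<δ hA hD h k = subst₂ _≤ℚ_
  (cong ℚ.∣_∣ (solve 4 (λ a b c d → a :* (c :- d) :+ d :* (a :- b) := a :* c :- b :* d) refl a b c d))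
  (half-sum δ)
  (ℚ.≤-trans (ℚ.∣p+q∣≤∣p∣+∣q∣ (a *ℚ (c -ℚ d)) (d *ℚ (a -ℚ b)))
    (ℚ.+-mono-≤ (*-bounded a (c -ℚ d) 0<A (half-pos 0<δ) hA h) (*-bounded d (a -ℚ b) 0<D (half-pos 0<δ) hD k)))

∣-∣≤ : ∀ a b {δ} → a -ℚ b ≤ℚ δ → b -ℚ a ≤ℚ δ → ℚ.∣ a -ℚ b ∣ ≤ℚ δ
∣-∣≤ a b {δ} h k = ∣∣≤ h (subst (_≤ℚ δ) (solve 2 (λ a b → b :- a := :- (a :- b)) refl a b) k)

∣-∣≤⇒≤+ : ∀ a b {δ} → ℚ.∣ a -ℚ b ∣ ≤ℚ δ → a ≤ℚ b +ℚ δ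
∣-∣≤⇒≤+ a b h = -≤⇒≤+ (ℚ.≤-trans (≤∣∣ (a -ℚ b)) h)

⊓-close : ∀ a b c d {δ} → ℚ.∣ a -ℚ c ∣ ≤ℚ δ → ℚ.∣ b -ℚ d ∣ ≤ℚ δ → ℚ.∣ (a ℚ.⊓ b) -ℚ (c ℚ.⊓ d) ∣ ≤ℚ δ
⊓-close a b c d {δ} h k = ∣-∣≤ (a ℚ.⊓ b) (c ℚ.⊓ d)
  (≤+⇒-≤ (⊓-lipschitz a b c d (∣-∣≤⇒≤+ a c h) (∣-∣≤⇒≤+ b d k)))
  (≤+⇒-≤ (⊓-lipschitz c d a b (∣-∣≤⇒≤+ c a (subst (_≤ℚ δ) (∣-∣-swap a c) h))
                               (∣-∣≤⇒≤+ d b (subst (_≤ℚ δ) (∣-∣-swap b d) k))))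

∣∣-shift : ∀ a b → ℚ.∣ a -ℚ b ∣ ≤ℚ 1ℚ → ℚ.∣ a ∣ ≤ℚ 1ℚ +ℚ ℚ.∣ b ∣
∣∣-shift a b h = subst (λ z → ℚ.∣ z ∣ ≤ℚ 1ℚ +ℚ ℚ.∣ b ∣)
  (solve 2 (λ a b → (a :- b) :+ b := a) refl a b)
  (ℚ.≤-trans (ℚ.∣p+q∣≤∣p∣+∣q∣ (a -ℚ b) b) (ℚ.+-monoˡ-≤ ℚ.∣ b ∣ h))

0<1+∣∣ : ∀ b → 0ℚ <ℚ 1ℚ +ℚ ℚ.∣ b ∣
0<1+∣∣ b = ℚ.positive⁻¹ _ {{ℚ.pos+nonNeg⇒pos 1ℚ ℚ.∣ b ∣ {{ℚ.∣-∣-nonNeg b}}}}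

recip-close : ∀ a b {η δ} → 0ℚ <ℚ η → 0ℚ <ℚ δ → 0ℚ +ℚ η ≤ℚ a → 0ℚ +ℚ η ≤ℚ b →
              ℚ.∣ a -ℚ b ∣ ≤ℚ η *ℚ η *ℚ δ → ℚ.∣ recip a -ℚ recip b ∣ ≤ℚ δ
recip-close a b {η} {δ} 0<η 0<δ ha hb h = subst₂ _≤ℚ_
     (trans (sym (cong (_*ℚ ℚ.∣ b -ℚ a ∣) (ℚ.0≤p⇒∣p∣≡p (ℚ.<⇒≤ 0<rr))))
       (trans (sym (ℚ.∣p*q∣≡∣p∣*∣q∣ (recip a *ℚ recip b) (b -ℚ a))) (cong ℚ.∣_∣ eq)))
     eq′
     (*-mono (ℚ.<⇒≤ 0<rr) (ℚ.<⇒≤ (*-pos (*-pos 0<η 0<η) 0<δ))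
       (*-mono (ℚ.<⇒≤ (recip-pos 0<a)) (ℚ.<⇒≤ (recip-pos 0<η))
         (recip-antitone 0<η η≤a) (recip-antitone 0<η η≤b))
       (subst (_≤ℚ η *ℚ η *ℚ δ) (∣-∣-swap a b) h))
  where
  η≤a : η ≤ℚ a
  η≤a = subst (_≤ℚ a) (ℚ.+-identityˡ η) ha
  η≤b : η ≤ℚ b
  η≤b = subst (_≤ℚ b) (ℚ.+-identityˡ η) hb
  0<a = ℚ.<-≤-trans 0<η η≤a
  0<b = ℚ.<-≤-trans 0<η η≤b
  0<rr = *-pos (recip-pos 0<a) (recip-pos 0<b)
  eq : (recip a *ℚ recip b) *ℚ (b -ℚ a) ≡ recip a -ℚ recip b
  eq = trans {j = recip a *ℚ (b *ℚ recip b) -ℚ recip b *ℚ (a *ℚ recip a)}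
         (solve 4 (λ a b r s → (r :* s) :* (b :- a) := r :* (b :* s) :- s :* (a :* r)) refl a b (recip a) (recip b))
         (cong₂ _-ℚ_ (trans (cong (recip a *ℚ_) (recip-inverse 0<b)) (ℚ.*-identityʳ (recip a)))
                     (trans (cong (recip b *ℚ_) (recip-inverse 0<a)) (ℚ.*-identityʳ (recip b))))
  eq′ : (recip η *ℚ recip η) *ℚ (η *ℚ η *ℚ δ) ≡ δ
  eq′ = trans (solve 3 (λ r e d → (r :* r) :* (e :* e :* d) := (e :* r) :* (e :* r) :* d) refl (recip η) η δ)
          (trans (cong (λ z → z *ℚ z *ℚ δ) (recip-inverse 0<η)) (trans (cong (_*ℚ δ) (ℚ.*-identityˡ 1ℚ)) (ℚ.*-identityˡ δ)))

harmonic : ℕ → ℕ → ℚ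
harmonic a = sum (λ j → 1/ℕ (a ℕ.+ j))

sum-cong : ∀ {f g} → (∀ j → f j ≡ g j) → ∀ l → sum f l ≡ sum g l
sum-cong h zero    = refl
sum-cong h (suc l) = cong₂ _+ℚ_ (sum-cong h l) (h l)

harmonic-+ : ∀ a l m → harmonic a (l ℕ.+ m) ≡ harmonic a l +ℚ harmonic (a ℕ.+ l) m
harmonic-+ a l zero rewrite ℕ.+-identityʳ l = sym (ℚ.+-identityʳ _)
harmonic-+ a l (suc m) rewrite ℕ.+-suc l m | harmonic-+ a l m | ℕ.+-assoc a l m = ℚ.+-assoc (harmonic a l) _ _

fromℕℚ-suc-* : ∀ m p → fromℕℚ (suc m) *ℚ p ≡ fromℕℚ m *ℚ p +ℚ p
fromℕℚ-suc-* m p = trans (cong (_*ℚ p) (fromℕℚ-+ 1 m))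
  (solve 2 (λ a b → (con 1ℚ :+ a) :* b := a :* b :+ b) refl (fromℕℚ m) p)

antitone⁺ : ∀ {a b} → 1 ℕ.≤ a → a ℕ.≤ b → 1/ℕ b ≤ℚ 1/ℕ a
antitone⁺ {suc a} {suc b} _ (s≤s le) = 1/ℕ-antitone le

harmonic-upper : ∀ a m → 1 ℕ.≤ a → harmonic a m ≤ℚ fromℕℚ m *ℚ 1/ℕ a
harmonic-upper a zero    _   = ℚ.≤-reflexive (sym (ℚ.*-zeroˡ (1/ℕ a)))
harmonic-upper a (suc m) 1≤a = subst (harmonic a (suc m) ≤ℚ_) (sym (fromℕℚ-suc-* m (1/ℕ a)))
  (ℚ.+-mono-≤ (harmonic-upper a m 1≤a) (antitone⁺ 1≤a (ℕ.m≤m+n a m)))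

harmonic-lower : ∀ a m b → 1 ℕ.≤ a → a ℕ.+ m ℕ.≤ b → fromℕℚ m *ℚ 1/ℕ b ≤ℚ harmonic a m
harmonic-lower a zero    b _   _  = ℚ.≤-reflexive (ℚ.*-zeroˡ (1/ℕ b))
harmonic-lower a (suc m) b 1≤a le = subst (_≤ℚ harmonic a (suc m)) (sym (fromℕℚ-suc-* m (1/ℕ b)))
  (ℚ.+-mono-≤ (harmonic-lower a m b 1≤a le′) (antitone⁺ (ℕ.≤-trans 1≤a (ℕ.m≤m+n a m)) le′))
  where
  le′ : a ℕ.+ m ℕ.≤ b
  le′ = ℕ.≤-trans (ℕ.+-monoʳ-≤ a (ℕ.n≤1+n m)) le

scale : ∀ c m → fromℕℚ (suc m) *ℚ 1/ℕ (suc c ℕ.* suc m) ≡ 1/ℕ (suc c)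
scale c m = Eq′.begin
  M *ℚ g                    Eq′.≡⟨ sym (ℚ.*-identityʳ _) ⟩
  M *ℚ g *ℚ 1ℚ              Eq′.≡⟨ cong (M *ℚ g *ℚ_) (sym (1/ℕ-inverse c)) ⟩
  M *ℚ g *ℚ (C *ℚ 1/ℕ (suc c)) Eq′.≡⟨ solve 4 (λ x y z w → x :* y :* (z :* w) := (z :* x) :* y :* w) refl M g C (1/ℕ (suc c)) ⟩
  (C *ℚ M) *ℚ g *ℚ 1/ℕ (suc c) Eq′.≡⟨ cong (λ z → z *ℚ g *ℚ 1/ℕ (suc c)) (sym (fromℕℚ-* (suc c) (suc m))) ⟩
  fromℕℚ (suc c ℕ.* suc m) *ℚ g *ℚ 1/ℕ (suc c) Eq′.≡⟨ cong (_*ℚ 1/ℕ (suc c)) (1/ℕ-inverse (m ℕ.+ c ℕ.* suc m)) ⟩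
  1ℚ *ℚ 1/ℕ (suc c)         Eq′.≡⟨ ℚ.*-identityˡ _ ⟩
  1/ℕ (suc c) Eq′.∎
  where
  module Eq′ = Relation.Binary.PropositionalEquality.≡-Reasoning
  M = fromℕℚ (suc m)
  C = fromℕℚ (suc c)
  g = 1/ℕ (suc c ℕ.* suc m)

block : ∀ c m → harmonic (suc c ℕ.* suc m) (suc m) ≤ℚ 1/ℕ (suc c)
block c m = subst (harmonic (suc c ℕ.* suc m) (suc m) ≤ℚ_) (scale c m) (harmonic-upper (suc c ℕ.* suc m) (suc m) (s≤s z≤n))

block′ : ∀ c m → 1/ℕ (suc (suc c)) ≤ℚ harmonic (suc c ℕ.* suc m) (suc m)
block′ c m = subst (_≤ℚ harmonic (suc c ℕ.* suc m) (suc m)) (scale (suc c) m)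
  (harmonic-lower (suc c ℕ.* suc m) (suc m) (suc (suc c) ℕ.* suc m) (s≤s z≤n)
    (ℕ.≤-reflexive (ℕ.+-comm (suc c ℕ.* suc m) (suc m))))

split-refined : ∀ K m l → harmonic (K ℕ.* m) (suc l ℕ.* m) ≡ harmonic (K ℕ.* m) (l ℕ.* m) +ℚ harmonic ((K ℕ.+ l) ℕ.* m) m
split-refined K m l = trans (cong (harmonic (K ℕ.* m)) (ℕ.+-comm m (l ℕ.* m)))
  (trans (harmonic-+ (K ℕ.* m) (l ℕ.* m) m)
    (cong (λ z → harmonic (K ℕ.* m) (l ℕ.* m) +ℚ harmonic z m) (sym (ℕ.*-distribʳ-+ m K l))))

refine-upper : ∀ k m l → harmonic (suc k ℕ.* suc m) (l ℕ.* suc m) ≤ℚ harmonic (suc k) l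
refine-upper k m zero    = ℚ.≤-refl
refine-upper k m (suc l) = subst (_≤ℚ harmonic (suc k) (suc l)) (sym (split-refined (suc k) (suc m) l))
  (ℚ.+-mono-≤ (refine-upper k m l) (block (k ℕ.+ l) m))

refine-lower : ∀ k m l → harmonic (suc (suc k)) l ≤ℚ harmonic (suc k ℕ.* suc m) (l ℕ.* suc m)
refine-lower k m zero    = ℚ.≤-refl
refine-lower k m (suc l) = subst (harmonic (suc (suc k)) (suc l) ≤ℚ_) (sym (split-refined (suc k) (suc m) l))
  (ℚ.+-mono-≤ (refine-lower k m l) (block′ (k ℕ.+ l) m))

harmonic-shift : ∀ a l → harmonic a l +ℚ 1/ℕ (a ℕ.+ l) ≡ harmonic (suc a) l +ℚ 1/ℕ a
harmonic-shift a zero rewrite ℕ.+-identityʳ a = refl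
harmonic-shift a (suc l) = trans (cong (_+ℚ 1/ℕ (a ℕ.+ suc l)) (harmonic-shift a l))
  (trans (solve 3 (λ x y z → x :+ y :+ z := x :+ z :+ y) refl (harmonic (suc a) l) (1/ℕ a) (1/ℕ (a ℕ.+ suc l)))
    (cong (λ z → harmonic (suc a) l +ℚ 1/ℕ z +ℚ 1/ℕ a) (ℕ.+-suc a l)))

harmonic≤shift : ∀ a l → harmonic a l ≤ℚ harmonic (suc a) l +ℚ 1/ℕ a
harmonic≤shift a l = subst (harmonic a l ≤ℚ_) (harmonic-shift a l)
  (subst (_≤ℚ harmonic a l +ℚ 1/ℕ (a ℕ.+ l)) (ℚ.+-identityʳ _) (ℚ.+-monoʳ-≤ (harmonic a l) (0≤1/ℕ (a ℕ.+ l))))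

riemann : ℕ → ℕ → ℚ
riemann n k = harmonic (suc k) ((n ℕ.∸ 1) ℕ.* suc k)

riemann-close : ∀ n k m → riemann n k ≤ℚ riemann n m +ℚ 1/ℕ (suc k)
riemann-close n k m = ℚ.≤-trans (harmonic≤shift (suc k) (N ℕ.* suc k)) (ℚ.+-monoˡ-≤ (1/ℕ (suc k))
    (ℚ.≤-trans (refine-lower k m (N ℕ.* suc k))
      (subst (_≤ℚ riemann n m) (cong₂ harmonic (ℕ.*-comm (suc m) (suc k)) eq) (refine-upper m k (N ℕ.* suc m)))))
  where
  N : ℕ
  N = n ℕ.∸ 1
  eq : N ℕ.* suc m ℕ.* suc k ≡ N ℕ.* suc k ℕ.* suc m
  eq = trans (ℕ.*-assoc N (suc m) (suc k)) (trans (cong (N ℕ.*_) (ℕ.*-comm (suc m) (suc k))) (sym (ℕ.*-assoc N (suc k) (suc m))))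

record ℝ : Set where
  field
    seq    : ℕ → ℚ
    cauchy : ∀ δ → 0ℚ <ℚ δ → ∃ λ N → ∀ i j → N ℕ.≤ i → N ℕ.≤ j →
             ℚ.∣ seq i -ℚ seq j ∣ ≤ℚ δ

open ℝ public

infix  4 _≤ᵣ_ _<ᵣ_
infixl 6 _+ᵣ_ _-ᵣ_
infixl 7 _*ᵣ_ _⊓ᵣ_
infix  8 -ᵣ_

_≤ᵣ_ : ℝ → ℝ → Set
x ≤ᵣ y = ∀ δ → 0ℚ <ℚ δ → ∃ λ N → ∀ i → N ℕ.≤ i → seq x i ≤ℚ seq y i +ℚ δ

_<ᵣ_ : ℝ → ℝ → Set
x <ᵣ y = ∃ λ δ → 0ℚ <ℚ δ × ∃ λ N → ∀ i → N ℕ.≤ i → seq x i +ℚ δ ≤ℚ seq y i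

fromℚ : ℚ → ℝ
fromℚ p .seq _ = p
fromℚ p .cauchy δ 0<δ = 0 , λ _ _ _ _ →
  subst (λ z → ℚ.∣ z ∣ ≤ℚ δ) (sym (ℚ.+-inverseʳ p)) (ℚ.<⇒≤ 0<δ)

fromℕ : ℕ → ℝ
fromℕ n = fromℚ (fromℕℚ n)

_+ᵣ_ : ℝ → ℝ → ℝ
(x +ᵣ y) .seq i = seq x i +ℚ seq y i
(x +ᵣ y) .cauchy δ 0<δ =
  let N , hx = cauchy x (δ *ℚ ½) (half-pos 0<δ)
      M , hy = cauchy y (δ *ℚ ½) (half-pos 0<δ)
  in N ℕ.⊔ M , λ i j ≤i ≤j → +-close (seq x i) (seq x j) (seq y i) (seq y j)
       (hx i j (ℕ.m⊔n≤o⇒m≤o N M ≤i) (ℕ.m⊔n≤o⇒m≤o N M ≤j))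
       (hy i j (ℕ.m⊔n≤o⇒n≤o N M ≤i) (ℕ.m⊔n≤o⇒n≤o N M ≤j))

-ᵣ_ : ℝ → ℝ
(-ᵣ x) .seq i = ℚ.- seq x i
(-ᵣ x) .cauchy δ 0<δ =
  let N , hx = cauchy x δ 0<δ
  in N , λ i j ≤i ≤j → neg-close (seq x i) (seq x j) (hx i j ≤i ≤j)

_-ᵣ_ : ℝ → ℝ → ℝ
x -ᵣ y = x +ᵣ (-ᵣ y)

bounded : ∀ x → ∃ λ B → 0ℚ <ℚ B × ∃ λ N → ∀ i → N ℕ.≤ i → ℚ.∣ seq x i ∣ ≤ℚ B
bounded x =
  let N , h = cauchy x 1ℚ (ℚ.positive⁻¹ 1ℚ)
  in 1ℚ +ℚ ℚ.∣ seq x N ∣ , 0<1+∣∣ (seq x N) , N ,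
     λ i ≤i → ∣∣-shift (seq x i) (seq x N) (h i N ≤i ℕ.≤-refl)

_*ᵣ_ : ℝ → ℝ → ℝ
(x *ᵣ y) .seq i = seq x i *ℚ seq y i
(x *ᵣ y) .cauchy δ 0<δ =
  let A , 0<A , N₁ , hA = bounded x
      B , 0<B , N₂ , hB = bounded y
      N₃ , hx = cauchy x (δ *ℚ ½ *ℚ recip B) (*-pos (half-pos 0<δ) (recip-pos 0<B))
      N₄ , hy = cauchy y (δ *ℚ ½ *ℚ recip A) (*-pos (half-pos 0<δ) (recip-pos 0<A))
      l : ∀ {k} → (N₁ ℕ.⊔ N₂) ℕ.⊔ (N₃ ℕ.⊔ N₄) ℕ.≤ k → N₁ ℕ.⊔ N₂ ℕ.≤ k
      l = ℕ.m⊔n≤o⇒m≤o (N₁ ℕ.⊔ N₂) (N₃ ℕ.⊔ N₄)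
      r : ∀ {k} → (N₁ ℕ.⊔ N₂) ℕ.⊔ (N₃ ℕ.⊔ N₄) ℕ.≤ k → N₃ ℕ.⊔ N₄ ℕ.≤ k
      r = ℕ.m⊔n≤o⇒n≤o (N₁ ℕ.⊔ N₂) (N₃ ℕ.⊔ N₄)
  in (N₁ ℕ.⊔ N₂) ℕ.⊔ (N₃ ℕ.⊔ N₄) , λ i j ≤i ≤j →
     *-close (seq x i) (seq x j) (seq y i) (seq y j) 0<A 0<B 0<δ
       (hA i (ℕ.m⊔n≤o⇒m≤o N₁ N₂ (l ≤i))) (hB j (ℕ.m⊔n≤o⇒n≤o N₁ N₂ (l ≤j)))
       (hy i j (ℕ.m⊔n≤o⇒n≤o N₃ N₄ (r ≤i)) (ℕ.m⊔n≤o⇒n≤o N₃ N₄ (r ≤j)))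
       (hx i j (ℕ.m⊔n≤o⇒m≤o N₃ N₄ (r ≤i)) (ℕ.m⊔n≤o⇒m≤o N₃ N₄ (r ≤j)))

_⊓ᵣ_ : ℝ → ℝ → ℝ
(x ⊓ᵣ y) .seq i = seq x i ℚ.⊓ seq y i
(x ⊓ᵣ y) .cauchy δ 0<δ =
  let N , hx = cauchy x δ 0<δ
      M , hy = cauchy y δ 0<δ
  in N ℕ.⊔ M , λ i j ≤i ≤j → ⊓-close (seq x i) (seq y i) (seq x j) (seq y j)
       (hx i j (ℕ.m⊔n≤o⇒m≤o N M ≤i) (ℕ.m⊔n≤o⇒m≤o N M ≤j))
       (hy i j (ℕ.m⊔n≤o⇒n≤o N M ≤i) (ℕ.m⊔n≤o⇒n≤o N M ≤j))

inv : (x : ℝ) → fromℕ 0 <ᵣ x → ℝ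
inv x _ .seq i = recip (seq x i)
inv x (η , 0<η , N , h) .cauchy δ 0<δ =
  let M , hx = cauchy x (η *ℚ η *ℚ δ) (*-pos (*-pos 0<η 0<η) 0<δ)
  in N ℕ.⊔ M , λ i j ≤i ≤j → recip-close (seq x i) (seq x j) 0<η 0<δ
       (h i (ℕ.m⊔n≤o⇒m≤o N M ≤i)) (h j (ℕ.m⊔n≤o⇒m≤o N M ≤j))
       (hx i j (ℕ.m⊔n≤o⇒n≤o N M ≤i) (ℕ.m⊔n≤o⇒n≤o N M ≤j))

-- ln n = ∫₁ⁿ dt/t, as the limit of left Riemann sums: with mesh 1/K, K = k + 1,
-- the j-th summand is (1/K) · 1/(1 + j/K) = 1/(K + j), for 0 ≤ j < (n - 1)K.
-- Only n ≥ 1 is meaningful.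
ln : ℕ → ℝ
ln n .seq k = sum (λ j → + 1 / (suc k ℕ.+ j)) ((n ℕ.∸ 1) ℕ.* suc k)
ln n .cauchy δ 0<δ =
  let N , h = archimedean δ 0<δ
      close : ∀ i j → N ℕ.≤ i → riemann n i -ℚ riemann n j ≤ℚ δ
      close i j ≤i = ≤+⇒-≤ (ℚ.≤-trans (riemann-close n i j)
        (ℚ.+-monoʳ-≤ (riemann n j) (ℚ.≤-trans (1/ℕ-antitone ≤i) h)))
  in N , λ i j ≤i ≤j → ∣-∣≤ (riemann n i) (riemann n j) (close i j ≤i) (close j i ≤j)

Graph : ℕ → Set
Graph n = List (Fin n × Fin n)

-- Edges are undirected: Connected closes Adjacent under symmetry too.
Adjacent : ∀ {n} → Graph n → Fin n → Fin n → Set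
Adjacent G u v = (u , v) ∈ˡ G

Connected : ∀ {n} → Graph n → Fin n → Fin n → Set
Connected G = EqClosure (Adjacent G)

private
  -- Equivalent to Connected ((a , b) ∷ G) u v.
  Via : ∀ {n} → Graph n → Fin n → Fin n → Fin n → Fin n → Set
  Via G a b u v = Connected G u v
                ⊎ (Connected G u a × Connected G b v)
                ⊎ (Connected G u b × Connected G a v)

  prepend : ∀ {n} {G : Graph n} {a b u w v} → Connected G u w → Via G a b w v → Via G a b u v
  prepend s (inj₁ c)              = inj₁ (s ◅◅ c)
  prepend s (inj₂ (inj₁ (c , d))) = inj₂ (inj₁ (s ◅◅ c , d))
  prepend s (inj₂ (inj₂ (c , d))) = inj₂ (inj₂ (s ◅◅ c , d))

  crossʳ : ∀ {n} {G : Graph n} {a b v} → Via G a b b v → Via G a b a v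
  crossʳ (inj₁ c)              = inj₂ (inj₁ (ε , c))
  crossʳ (inj₂ (inj₁ (_ , d))) = inj₂ (inj₁ (ε , d))
  crossʳ (inj₂ (inj₂ (_ , d))) = inj₁ d

  crossˡ : ∀ {n} {G : Graph n} {a b v} → Via G a b a v → Via G a b b v
  crossˡ (inj₁ c)              = inj₂ (inj₂ (ε , c))
  crossˡ (inj₂ (inj₁ (_ , d))) = inj₁ d
  crossˡ (inj₂ (inj₂ (_ , d))) = inj₂ (inj₂ (ε , d))

  toVia : ∀ {n} {G : Graph n} {a b u v} → Connected ((a , b) ∷ G) u v → Via G a b u v
  toVia ε                        = inj₁ ε
  toVia (fwd (here refl) ◅ s)    = crossʳ (toVia s)
  toVia (fwd (there e)   ◅ s)    = prepend (fwd e ◅ ε) (toVia s)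
  toVia (bwd (here refl) ◅ s)    = crossˡ (toVia s)
  toVia (bwd (there e)   ◅ s)    = prepend (bwd e ◅ ε) (toVia s)

  fromVia : ∀ {n} {G : Graph n} {a b u v} → Via G a b u v → Connected ((a , b) ∷ G) u v
  fromVia (inj₁ c)              = Eq.map there c
  fromVia (inj₂ (inj₁ (c , d))) = Eq.map there c ◅◅ (fwd (here refl) ◅ Eq.map there d)
  fromVia (inj₂ (inj₂ (c , d))) = Eq.map there c ◅◅ (bwd (here refl) ◅ Eq.map there d)

connected? : ∀ {n} (G : Graph n) u v → Dec (Connected G u v)
connected? []            u v = map′ (λ { refl → ε }) edgeless (u Fin.≟ v)
  where
  edgeless : ∀ {u v} → Connected [] u v → u ≡ v
  edgeless ε            = refl
  edgeless (fwd () ◅ _)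
  edgeless (bwd () ◅ _)
connected? ((a , b) ∷ G) u v = map′ fromVia toVia
  (connected? G u v ⊎-dec ((connected? G u a ×-dec connected? G b v)
                     ⊎-dec (connected? G u b ×-dec connected? G a v)))

component : ∀ {n} → Graph n → Fin n → Subset n
component G v = tabulate (λ u → does (connected? G v u))

largestOrder : ∀ {n} → Graph n → ℕ
largestOrder {n} G = max 0 (map (λ v → ∣ component G v ∣) (allFin n))

edges : ∀ n → List (Fin n × Fin n)
edges n = filter (λ (u , v) → u Fin.<? v) (cartesianProduct (allFin n) (allFin n))

Edge : ℕ → Set
Edge n = Fin (length (edges n))

EdgeSet : ℕ → Set
EdgeSet n = Subset (length (edges n))

-- The edges neither free nor Client's belong to Waiter.
record Position (n : ℕ) : Set where
  constructor position
  field
    free   : EdgeSet n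
    client : List (Edge n)

open Position public

clientGraph : ∀ {n} → Position n → Graph n
clientGraph {n} p = map (lookup (edges n)) (client p)

start : ∀ n → Position n
start n = position ⊤ []

IsOffer : ∀ {n} → ℕ → Position n → EdgeSet n → Set
IsOffer q p O = O ⊆ free p × ∣ O ∣ ≡ suc q

Offer : ∀ {n} → ℕ → Position n → Set
Offer q p = ∃ (IsOffer q p)

-- Positions never recur during a play, so letting a strategy see only the
-- current position, and not the whole history, loses no generality.
WaiterStrategy : ℕ → ℕ → Set
WaiterStrategy n q = (p : Position n) → suc q ℕ.≤ ∣ free p ∣ → Offer q p

ClientStrategy : ℕ → ℕ → Set
ClientStrategy n q = (p : Position n) (O : Offer q p) → ∃ λ e → e ∈ proj₁ O

claim : ∀ {n} → Position n → EdgeSet n → Edge n → Position n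
claim p O e = position (free p ─ O) (e ∷ client p)

-- Waiter takes all the remaining edges.
finish : ∀ {n} → Position n → Position n
finish p = position ⊥ (client p)

module _ {n q : ℕ} where

  round : WaiterStrategy n q → ClientStrategy n q → Position n → Position n
  round σ τ p with suc q ℕ.≤? ∣ free p ∣
  ... | yes enough = claim p (proj₁ (σ p enough)) (proj₁ (τ p (σ p enough)))
  ... | no  _      = finish p

  play : WaiterStrategy n q → ClientStrategy n q → ℕ → Position n → Position n
  play σ τ zero    p = p
  play σ τ (suc k) p = play σ τ k (round σ τ p)

  -- The number of edges bounds the number of rounds (see game-over below);
  -- further rounds change nothing.
  final : WaiterStrategy n q → ClientStrategy n q → Position n
  final σ τ = play σ τ (length (edges n)) (start n)

  outcome : WaiterStrategy n q → ClientStrategy n q → ℕ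
  outcome σ τ = largestOrder (clientGraph (final σ τ))

ClientCanEnsure : ℕ → ℕ → (ℕ → Set) → Set
ClientCanEnsure n q P = ∃ λ (τ : ClientStrategy n q) → ∀ (σ : WaiterStrategy n q) → P (outcome σ τ)

WaiterCanEnsure : ℕ → ℕ → (ℕ → Set) → Set
WaiterCanEnsure n q P = ∃ λ (σ : WaiterStrategy n q) → ∀ (τ : ClientStrategy n q) → P (outcome σ τ)

subsets : ∀ m → List (Subset m)
subsets zero    = Vec.[] ∷ []
subsets (suc m) = map (inside Vec.∷_) (subsets m) ++ map (outside Vec.∷_) (subsets m)

elements : ∀ {m} → Subset m → List (Fin m)
elements {m} O = filter (_∈? O) (allFin m)

isOffer? : ∀ {n} q (p : Position n) → Decidable (IsOffer q p)
isOffer? q p O = (O ⊆? free p) ×-dec (∣ O ∣ ℕ.≟ suc q)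

offers : ∀ {n} → ℕ → Position n → List (EdgeSet n)
offers q p = filter (isOffer? q p) (subsets _)

-- The minimum is over a nonempty list of values, none of them above n.
mutual
  value : ∀ {n} → ℕ → ℕ → Position n → ℕ
  value q zero    p = largestOrder (clientGraph p)
  value q (suc k) p with suc q ℕ.≤? ∣ free p ∣
  ... | yes _ = max 0 (map (offerValue q k p) (offers q p))
  ... | no  _ = value q k (finish p)

  offerValue : ∀ {n} → ℕ → ℕ → Position n → EdgeSet n → ℕ
  offerValue {n} q k p O = min n (map (λ e → value q k (claim p O e)) (elements O))

𝓛 : ℕ → ℕ → ℕ
𝓛 n q = value q (length (edges n)) (start n)

-- The rest shows that the backward-induction value 𝓛 n q is the outcome of optimal
-- play: each player has a strategy guaranteeing it (client-optimal, waiter-optimal).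

∈-subsets : ∀ {m} (O : Subset m) → O ∈ˡ subsets m
∈-subsets Vec.[]              = here refl
∈-subsets (inside  Vec.∷ O) = ∈-++⁺ˡ (∈-map⁺ (inside Vec.∷_) (∈-subsets O))
∈-subsets (outside Vec.∷ O) = ∈-++⁺ʳ (map (inside Vec.∷_) (subsets _)) (∈-map⁺ (outside Vec.∷_) (∈-subsets O))

∈-elements⁺ : ∀ {m} {O : Subset m} {e} → e ∈ O → e ∈ˡ elements O
∈-elements⁺ {O = O} {e} e∈O = ∈-filter⁺ (_∈? O) (∈-allFin e) e∈O

∈-elements⁻ : ∀ {m} {O : Subset m} {e} → e ∈ˡ elements O → e ∈ O
∈-elements⁻ {m} {O} e∈ = proj₂ (∈-filter⁻ (_∈? O) {xs = allFin m} e∈)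

∈-offers⁺ : ∀ {n} q (p : Position n) {O} → IsOffer q p O → O ∈ˡ offers q p
∈-offers⁺ q p {O} legal = ∈-filter⁺ (isOffer? q p) (∈-subsets O) legal

∈-offers⁻ : ∀ {n} q (p : Position n) {O} → O ∈ˡ offers q p → IsOffer q p O
∈-offers⁻ q p O∈ = proj₂ (∈-filter⁻ (isOffer? q p) {xs = subsets _} O∈)

nonempty : ∀ {m k} (O : Subset m) → ∣ O ∣ ≡ suc k → ∃ λ e → e ∈ O
nonempty (inside  Vec.∷ O) _  = zero , Vec.here
nonempty (outside Vec.∷ O) eq with nonempty O eq
... | e , e∈O = suc e , Vec.there e∈O

subset-of-size : ∀ {m} k (F : Subset m) → k ℕ.≤ ∣ F ∣ → ∃ λ O → O ⊆ F × ∣ O ∣ ≡ k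
subset-of-size {m} zero F _ = ⊥ , ⊥⊆ , ∣⊥∣≡0 m
subset-of-size (suc k) (inside Vec.∷ F) (s≤s le) with subset-of-size k F le
... | O , O⊆F , eq = inside Vec.∷ O , s⊆s O⊆F , cong suc eq
subset-of-size (suc k) (outside Vec.∷ F) le with subset-of-size (suc k) F le
... | O , O⊆F , eq = outside Vec.∷ O , out⊆ O⊆F , eq

maximiser : ∀ {A : Set} (f : A → ℕ) xs {x} → x ∈ˡ xs → ∃ λ y → y ∈ˡ xs × All (λ z → f z ℕ.≤ f y) xs
maximiser f (x ∷ xs) _ with argmax-sel f x xs
... | inj₁ eq = argmax f x xs , here eq , f[⊥]≤f[argmax] {f = f} x xs All.∷ f[xs]≤f[argmax] {f = f} x xs
... | inj₂ ∈xs = argmax f x xs , there ∈xs , f[⊥]≤f[argmax] {f = f} x xs All.∷ f[xs]≤f[argmax] {f = f} x xs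

minimiser : ∀ {A : Set} (f : A → ℕ) xs {x} → x ∈ˡ xs → ∃ λ y → y ∈ˡ xs × All (λ z → f y ℕ.≤ f z) xs
minimiser f (x ∷ xs) _ with argmin-sel f x xs
... | inj₁ eq = argmin f x xs , here eq , f[argmin]≤f[⊤] {f = f} x xs All.∷ f[argmin]≤f[xs] {f = f} x xs
... | inj₂ ∈xs = argmin f x xs , there ∈xs , f[argmin]≤f[⊤] {f = f} x xs All.∷ f[argmin]≤f[xs] {f = f} x xs

claim-shrinks : ∀ {n q} (p : Position n) {O} → IsOffer q p O → ∣ free p ─ O ∣ ℕ.< ∣ free p ∣
claim-shrinks p {O} (O⊆ , eq) with nonempty O eq
... | e , e∈O = p∩q≢∅⇒∣p─q∣<∣p∣ (free p) O (e , x∈p∩q⁺ (O⊆ e∈O , e∈O))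

private
  ∣finish∣≤ : ∀ {n} (p : Position n) {k} → ∣ free (finish p) ∣ ℕ.≤ k
  ∣finish∣≤ {n} p {k} = subst (ℕ._≤ k) (sym (∣⊥∣≡0 (length (edges n)))) z≤n

  pred-≤ : ∀ {a b c} → a ℕ.< b → b ℕ.≤ suc c → a ℕ.≤ c
  pred-≤ lt le = ℕ.≤-pred (ℕ.≤-trans lt le)

value-stable : ∀ {n} q k l (p : Position n) → ∣ free p ∣ ℕ.≤ k → ∣ free p ∣ ℕ.≤ l → value q k p ≡ value q l p
value-stable q zero    zero    p _ _ = refl
value-stable q zero    (suc l) p le _ with suc q ℕ.≤? ∣ free p ∣
... | yes enough = contradiction (ℕ.≤-trans enough le) λ ()
... | no  _      = value-stable q zero l (finish p) (∣finish∣≤ p) (∣finish∣≤ p)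
value-stable q (suc k) zero    p _ le with suc q ℕ.≤? ∣ free p ∣
... | yes enough = contradiction (ℕ.≤-trans enough le) λ ()
... | no  _      = value-stable q k zero (finish p) (∣finish∣≤ p) (∣finish∣≤ p)
value-stable {n} q (suc k) (suc l) p lek lel with suc q ℕ.≤? ∣ free p ∣
... | no  _ = value-stable q k l (finish p) (∣finish∣≤ p) (∣finish∣≤ p)
... | yes _ = cong (max 0) (map-cong-local (All.tabulate λ {O} O∈ → cong (min n) (map-cong-local {xs = elements O}
      (All.tabulate λ {e} _ → value-stable q k l (claim p O e)
        (pred-≤ (claim-shrinks p (∈-offers⁻ q p O∈)) lek)
        (pred-≤ (claim-shrinks p (∈-offers⁻ q p O∈)) lel)))))

value≤n : ∀ {n} q k (p : Position n) → value q k p ℕ.≤ n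
value≤n {n} q zero    p = max≤v⁺ {xs = map (λ v → ∣ component (clientGraph p) v ∣) (allFin n)} z≤n
  (All.map⁺ (All.tabulate λ {v} _ → ∣p∣≤n (component (clientGraph p) v)))
value≤n {n} q (suc k) p with suc q ℕ.≤? ∣ free p ∣
... | yes _ = max≤v⁺ {xs = map (offerValue q k p) (offers q p)} z≤n
  (All.map⁺ (All.tabulate λ {O} _ → min≤⊤ n (map (λ e → value q k (claim p O e)) (elements O))))
... | no  _ = value≤n q k (finish p)

-- Optimal strategies measure a position by its value with the game run to its end.
module _ {n q : ℕ} where

  val : Position n → ℕ
  val p = value q ∣ free p ∣ p

  offerVal : Position n → EdgeSet n → ℕ
  offerVal p = offerValue q (∣ free p ∣) p

  bestOffer : (p : Position n) → suc q ℕ.≤ ∣ free p ∣ →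
              ∃ λ O → O ∈ˡ offers q p × All (λ O′ → offerVal p O′ ℕ.≤ offerVal p O) (offers q p)
  bestOffer p enough = maximiser (offerVal p) (offers q p)
    (∈-offers⁺ q p (proj₂ (subset-of-size (suc q) (free p) enough)))

  bestChoice : (p : Position n) (O : Offer q p) →
               ∃ λ e → e ∈ˡ elements (proj₁ O) ×
                       All (λ e′ → val (claim p (proj₁ O) e) ℕ.≤ val (claim p (proj₁ O) e′)) (elements (proj₁ O))
  bestChoice p (O , _ , eq) = minimiser (λ e → val (claim p O e)) (elements O)
    (∈-elements⁺ (proj₂ (nonempty O eq)))

  waiter* : WaiterStrategy n q
  waiter* p enough = let O , O∈ , _ = bestOffer p enough in O , ∈-offers⁻ q p O∈

  client* : ClientStrategy n q
  client* p O = let e , e∈ , _ = bestChoice p O in e , ∈-elements⁻ e∈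

  offerValue-stable : ∀ k l (p : Position n) {O} → IsOffer q p O → ∣ free p ∣ ℕ.≤ suc k → ∣ free p ∣ ℕ.≤ suc l →
                      offerValue q k p O ≡ offerValue q l p O
  offerValue-stable k l p {O} legal lek lel = cong (min n) (map-cong-local {xs = elements O} (All.tabulate λ {e} _ →
    value-stable q k l (claim p O e) (pred-≤ (claim-shrinks p legal) lek) (pred-≤ (claim-shrinks p legal) lel)))

  game-over : ∀ (σ : WaiterStrategy n q) τ k p → ∣ free p ∣ ℕ.≤ k → ∣ free (play σ τ k p) ∣ ≡ 0
  game-over σ τ zero    p le = ℕ.n≤0⇒n≡0 le
  game-over σ τ (suc k) p le with suc q ℕ.≤? ∣ free p ∣
  ... | yes enough = game-over σ τ k _ (pred-≤ (claim-shrinks p (proj₂ (σ p enough))) le)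
  ... | no  _      = game-over σ τ k _ (∣finish∣≤ p)

  client*-play : ∀ (σ : WaiterStrategy n q) k p → ∣ free p ∣ ℕ.≤ k →
                 largestOrder (clientGraph (play σ client* k p)) ℕ.≤ value q k p
  client*-play σ zero    p _  = ℕ.≤-refl
  client*-play σ (suc k) p le with suc q ℕ.≤? ∣ free p ∣
  ... | no  _      = client*-play σ k (finish p) (∣finish∣≤ p)
  ... | yes enough = ℕ.≤-trans (client*-play σ k (claim p O e) (pred-≤ shrinks le))
      (ℕ.≤-trans (v≤min⁺ {xs = map (λ e′ → value q k (claim p O e′)) (elements O)}
          (value≤n q k (claim p O e)) (All.map⁺ (All.map below best)))
        (All.lookup (xs≤max 0 (map (offerValue q k p) (offers q p)))
          (∈-map⁺ (offerValue q k p) (∈-offers⁺ q p legal))))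
    where
    O : EdgeSet n
    O = proj₁ (σ p enough)
    legal : IsOffer q p O
    legal = proj₂ (σ p enough)
    shrinks = claim-shrinks p legal
    e : Edge n
    e = proj₁ (bestChoice p (σ p enough))
    best = proj₂ (proj₂ (bestChoice p (σ p enough)))
    stable : ∀ e′ → val (claim p O e′) ≡ value q k (claim p O e′)
    stable e′ = value-stable q _ k (claim p O e′) ℕ.≤-refl (pred-≤ shrinks le)
    below : ∀ {e′} → val (claim p O e) ℕ.≤ val (claim p O e′) →
            value q k (claim p O e) ℕ.≤ value q k (claim p O e′)
    below {e′} = subst₂ ℕ._≤_ (stable e) (stable e′)

  waiter*-play : ∀ (τ : ClientStrategy n q) k p → ∣ free p ∣ ℕ.≤ k →
                 value q k p ℕ.≤ largestOrder (clientGraph (play waiter* τ k p))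
  waiter*-play τ zero    p _  = ℕ.≤-refl
  waiter*-play τ (suc k) p le with suc q ℕ.≤? ∣ free p ∣
  ... | no  _      = waiter*-play τ k (finish p) (∣finish∣≤ p)
  ... | yes enough = ℕ.≤-trans
      (max≤v⁺ {xs = map (offerValue q k p) (offers q p)} z≤n (All.map⁺ (All.tabulate λ {O′} O′∈ →
        subst₂ ℕ._≤_ (stable (∈-offers⁻ q p O′∈)) (stable legal) (All.lookup best O′∈))))
      (ℕ.≤-trans (All.lookup (min≤xs n (map (λ e′ → value q k (claim p O e′)) (elements O)))
          (∈-map⁺ (λ e′ → value q k (claim p O e′)) (∈-elements⁺ (proj₂ choice))))
        (waiter*-play τ k (claim p O (proj₁ choice)) (pred-≤ (claim-shrinks p legal) le)))
    where
    O : EdgeSet n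
    O = proj₁ (bestOffer p enough)
    legal : IsOffer q p O
    legal = proj₂ (waiter* p enough)
    best = proj₂ (proj₂ (bestOffer p enough))
    choice : ∃ λ e → e ∈ O
    choice = τ p (waiter* p enough)
    stable : ∀ {O′} → IsOffer q p O′ → offerVal p O′ ≡ offerValue q k p O′
    stable legal′ = offerValue-stable ∣ free p ∣ k p legal′ (ℕ.n≤1+n _) le

  private
    ∣start∣≤ : ∣ free (start n) ∣ ℕ.≤ length (edges n)
    ∣start∣≤ = ℕ.≤-reflexive (∣⊤∣≡n (length (edges n)))

  final-free : ∀ (σ : WaiterStrategy n q) τ → ∣ free (final σ τ) ∣ ≡ 0
  final-free σ τ = game-over σ τ _ (start n) ∣start∣≤

  client-optimal : ∀ σ → outcome σ client* ℕ.≤ 𝓛 n q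
  client-optimal σ = client*-play σ _ (start n) ∣start∣≤

  waiter-optimal : ∀ τ → 𝓛 n q ℕ.≤ outcome waiter* τ
  waiter-optimal τ = waiter*-play τ _ (start n) ∣start∣≤

{-# OPTIONS --safe #-}
module Submission where

-- Both parts bound the value 𝓛 n q; backward induction then supplies the strategies.
--
-- Client.  Let N = q + 1 and give an edge the weight N, 1 or 0 if it is Client's, free or
-- Waiter's.  Client watches the weighted number of trees grown from a root by K successive
-- self-avoiding walks, each of which starts at a vertex visited before.  This potential is
-- multilinear in the weights, so its average over the N answers to an offer is at most its
-- present value, and some answer does not increase it.  A component of order s alone
-- accounts for s ^ K such trees, because the ends of the walks can be prescribed, while the
-- initial potential is at most n (O(K / ε²)) ^ K on the same scale.  For K ≈ log₂ n the
-- K-th root gives s = O(ε⁻² ln n).  (Counting all trees on s vertices would lose a factor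
-- exp(s) and miss the threshold q = n.)
--
-- Waiter.  He builds a tree and always offers all free edges between the tree and a set of
-- outside vertices, chosen so that these are exactly q + 1 edges: then no edge is left
-- unused inside the tree.  The numbers of free edges from the outside vertices to the tree
-- develop independently of Client's answers.  With b = n - 2 - q ≤ q they start as n - 1
-- ones; when the tree has i + 2 ≤ b + 2 vertices they are q - i ones, the numbers
-- 2, ..., i + 1, and b - i copies of i + 2, of which Waiter uses q - i - 1 ones and one
-- i + 2; afterwards he uses the q - b ones and the largest number b + 1, until the tree has
-- 2 b + 2 = 2 (n - q) - 2 vertices.  If n > 2 q + 2, he does this with b = q on 2 q + 2
-- vertices; each vertex left then has at least q + 1 free edges to the tree and can be
-- attached on its own.

open import Algebra.Properties.CommutativeSemigroup using (interchange; x∙yz≈y∙xz)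
open import Data.Bool.Base using (if_then_else_)
open import Data.Fin.Base as Fin using (Fin; zero; suc)
import Data.Fin.Properties as Fin
open import Data.Fin.Subset using (Subset; inside; outside; ⊤; ⊥; _∈_; _∉_; _─_; _-_; ∣_∣)
open import Data.Fin.Subset.Properties
  using (_∈?_; x∈p⇒∣p-x∣<∣p∣; x∈p∧x≢y⇒x∈p-y; x∈p∧x∉q⇒x∈p─q; ∣⊥∣≡0; ∣⊤∣≡n; ∈⊤; ∉⊥; p⊆q⇒∣p∣≤∣q∣; p─⊥≡p; p─q⊆p; x∈⁅x⁆)
open import Data.List.Base
  using (List; []; _∷_; [_]; _++_; map; filter; cartesianProduct; allFin; lookup; length; replicate; take)
open import Data.List.Extrema.Nat using (max≤v⁺; v≤min⁺; xs≤max; min≤xs)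
import Data.List.Membership.DecPropositional as DecMembership
open import Data.List.Membership.Propositional using () renaming (_∈_ to _∈ˡ_; _∉_ to _∉ˡ_)
open import Data.List.Membership.Propositional.Properties
  using (∈-filter⁺; ∈-filter⁻; ∈-allFin; ∈-lookup; ∈-cartesianProduct⁺; ∈-map⁺; ∈-map⁻; ∈-++⁺ˡ; ∈-++⁺ʳ; ∈-∃++)
import Data.List.Properties as List
open import Data.List.Relation.Binary.Permutation.Propositional
  using (_↭_; ↭-refl; ↭-sym; ↭-trans; ↭-reflexive; ↭-prep; ↭-swap; ↭⇒↭ₛ)
import Data.List.Relation.Binary.Permutation.Propositional.Properties as Perm
import Data.List.Relation.Binary.Permutation.Setoid.Properties as PermSetoid
open import Data.List.Relation.Unary.All as All using (All; []; _∷_)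
import Data.List.Relation.Unary.All.Properties as All
open import Data.List.Relation.Unary.AllPairs using ([]; _∷_)
open import Data.List.Relation.Unary.Any as Any using (here; there)
open import Data.List.Relation.Unary.Any.Properties using (lookup-index)
open import Data.List.Relation.Unary.Unique.Propositional using (Unique)
import Data.List.Relation.Unary.Unique.Propositional.Properties as Unique
open import Data.Nat.Base as ℕ using (ℕ; zero; suc; z≤n; s≤s; _≤_; _<_; _+_; _*_; _∸_; _^_)
import Data.Nat.ListAction as ListAction
import Data.Nat.ListAction.Properties as ListAction
import Data.Nat.Properties as ℕ
open import Data.Nat.Tactic.RingSolver using (solve-∀)
open import Data.Product.Base using (∃; ∃₂; _×_; _,_; proj₁; proj₂; map₂)
open import Data.Rational.Base as ℚ using (ℚ; 0ℚ; 1ℚ; ½)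
  renaming (_+_ to _+ℚ_; _*_ to _*ℚ_; _-_ to _-ℚ_; _≤_ to _≤ℚ_; _<_ to _<ℚ_)
import Data.Rational.Properties as ℚ
open import Data.Rational.Solver using (module +-*-Solver)
open import Data.Sum.Base using (_⊎_; inj₁; inj₂)
open import Data.Vec.Base as Vec using (tabulate)
import Data.Vec.Properties as Vec
open import Function.Base using (_∘_)
import Relation.Binary.Construct.Closure.Equivalence as Eq
open import Relation.Binary.Construct.Closure.ReflexiveTransitive using (_◅_; _◅◅_) renaming (ε to stay)
open import Relation.Binary.Construct.Closure.Symmetric using (SymClosure; fwd; bwd)
open import Relation.Binary.Definitions using (tri<; tri≈; tri>)
open import Relation.Binary.PropositionalEquality
  using (_≡_; _≢_; refl; sym; trans; cong; cong₂; subst; subst₂; setoid)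
open import Relation.Nullary using (Dec; yes; no; does; ¬_; contradiction; ¬?)
open import Relation.Nullary.Decidable using (dec-true)
open import Relation.Unary using (Decidable)
open import Defs

open +-*-Solver using (solve; _:+_; _:*_; _:-_; _:=_; con)

-- Finite subsets, and the edges of the complete graph as unordered pairs.

lookup-injective : ∀ {A : Set} {xs : List A} → Unique xs → ∀ i j → lookup xs i ≡ lookup xs j → i ≡ j
lookup-injective (_  ∷ _) zero    zero    _  = refl
lookup-injective (x≢ ∷ _) zero    (suc j) eq = contradiction eq (All.lookup x≢ (∈-lookup j))
lookup-injective (x≢ ∷ _) (suc i) zero    eq = contradiction (sym eq) (All.lookup x≢ (∈-lookup i))
lookup-injective (_  ∷ u) (suc i) (suc j) eq = cong suc (lookup-injective u i j eq)

x∈p─q⇒x∉q : ∀ {m} {p q : Subset m} {x} → x ∈ p ─ q → x ∉ q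
x∈p─q⇒x∉q {p = _ Vec.∷ _} {q = inside  Vec.∷ q} (Vec.there x∈) (Vec.there x∈q) = x∈p─q⇒x∉q x∈ x∈q
x∈p─q⇒x∉q {p = _ Vec.∷ _} {q = outside Vec.∷ q} (Vec.there x∈) (Vec.there x∈q) = x∈p─q⇒x∉q x∈ x∈q

∣p∣≤1+∣p-x∣ : ∀ {m} (p : Subset m) x → ∣ p ∣ ≤ suc ∣ p - x ∣
∣p∣≤1+∣p-x∣ (outside Vec.∷ p) zero    = ℕ.m≤n⇒m≤1+n (ℕ.≤-reflexive (cong ∣_∣ (sym (p─⊥≡p p))))
∣p∣≤1+∣p-x∣ (inside  Vec.∷ p) zero    = s≤s (ℕ.≤-reflexive (cong ∣_∣ (sym (p─⊥≡p p))))
∣p∣≤1+∣p-x∣ (outside Vec.∷ p) (suc x) = ∣p∣≤1+∣p-x∣ p x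
∣p∣≤1+∣p-x∣ (inside  Vec.∷ p) (suc x) = s≤s (∣p∣≤1+∣p-x∣ p x)

unique⇒length≤∣p∣ : ∀ {m} {p : Subset m} {xs} → Unique xs → All (_∈ p) xs → length xs ≤ ∣ p ∣
unique⇒length≤∣p∣ [] [] = z≤n
unique⇒length≤∣p∣ {p = p} {x ∷ xs} (x≢ ∷ u) (x∈p ∷ xs⊆p) = ℕ.≤-<-trans
  (unique⇒length≤∣p∣ u (All.zipWith (λ (x≢y , y∈p) → x∈p∧x≢y⇒x∈p-y y∈p (x≢y ∘ sym)) (x≢ , xs⊆p)))
  (x∈p⇒∣p-x∣<∣p∣ x∈p)

∣p∣≤length : ∀ {m} (p : Subset m) xs → (∀ {x} → x ∈ p → x ∈ˡ xs) → ∣ p ∣ ≤ length xs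
∣p∣≤length {m} p [] p⊆ = subst (∣ p ∣ ≤_) (∣⊥∣≡0 m) (p⊆q⇒∣p∣≤∣q∣ {p = p} {q = ⊥} (λ x∈p → contradiction (p⊆ x∈p) λ ()))
∣p∣≤length p (x ∷ xs) p⊆ = ℕ.≤-trans (∣p∣≤1+∣p-x∣ p x) (s≤s (∣p∣≤length (p - x) xs p-x⊆))
  where
  p-x⊆ : ∀ {y} → y ∈ p - x → y ∈ˡ xs
  p-x⊆ y∈ with p⊆ (p─q⊆p p _ y∈)
  ... | here refl = contradiction (x∈⁅x⁆ _) (x∈p─q⇒x∉q {p = p} y∈)
  ... | there y∈xs = y∈xs

module _ {m} {P : Fin m → Set} (P? : Decidable P) where

  subset : Subset m
  subset = tabulate (does ∘ P?)

  ∈-subset⁺ : ∀ {x} → P x → x ∈ subset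
  ∈-subset⁺ {x} px = Vec.lookup⇒[]= x subset (trans (Vec.lookup∘tabulate _ x) (dec-true (P? x) px))

  ∈-subset⁻ : ∀ {x} → x ∈ subset → P x
  ∈-subset⁻ {x} x∈ with P? x | trans (sym (Vec.lookup∘tabulate (does ∘ P?) x)) (Vec.[]=⇒lookup x∈)
  ... | yes px | _ = px
  ... | no  _  | ()

elements-unique : ∀ {m} (p : Subset m) → Unique (elements p)
elements-unique p = Unique.filter⁺ (_∈? p) (Unique.allFin⁺ _)

length-elements : ∀ {m} (p : Subset m) → length (elements p) ≡ ∣ p ∣
length-elements p = ℕ.≤-antisym
  (unique⇒length≤∣p∣ (elements-unique p) (All.tabulate ∈-elements⁻))
  (∣p∣≤length p (elements p) ∈-elements⁺)

module _ {n : ℕ} where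

  -- `edges n` lists each pair once, with the smaller end first, so an edge between two given
  -- vertices may be stored in either orientation.
  Joins : Edge n → Fin n → Fin n → Set
  Joins e a b = lookup (edges n) e ≡ (a , b) ⊎ lookup (edges n) e ≡ (b , a)

  private
    ordered : ∀ {e a b} → lookup (edges n) e ≡ (a , b) → a Fin.< b
    ordered {e} eq = subst (λ (a , b) → a Fin.< b) eq
      (proj₂ (∈-filter⁻ (λ (u , v) → u Fin.<? v) {xs = cartesianProduct (allFin n) (allFin n)} (∈-lookup e)))

    same : ∀ {e f a b} → lookup (edges n) e ≡ (a , b) → lookup (edges n) f ≡ (a , b) → e ≡ f
    same {e} {f} eq eq′ = lookup-injective
      (Unique.filter⁺ (λ (u , v) → u Fin.<? v) (Unique.cartesianProduct⁺ (Unique.allFin⁺ n) (Unique.allFin⁺ n)))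
      e f (trans eq (sym eq′))

    opposite : ∀ {e f a b} → lookup (edges n) e ≡ (a , b) → lookup (edges n) f ≡ (b , a) → e ≡ f
    opposite eq eq′ = contradiction (ordered eq′) (ℕ.<-asym (ordered eq))

    present : ∀ {a b} → a Fin.< b → ∃ λ e → lookup (edges n) e ≡ (a , b)
    present {a} {b} a<b = Any.index ab∈ , sym (lookup-index ab∈)
      where
      ab∈ : (a , b) ∈ˡ edges n
      ab∈ = ∈-filter⁺ (λ (u , v) → u Fin.<? v) (∈-cartesianProduct⁺ (∈-allFin a) (∈-allFin b)) a<b

  joins-unique : ∀ {e f a b} → Joins e a b → Joins f a b → e ≡ f
  joins-unique (inj₁ p) (inj₁ q) = same p q
  joins-unique (inj₁ p) (inj₂ q) = opposite p q
  joins-unique (inj₂ p) (inj₁ q) = opposite p q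
  joins-unique (inj₂ p) (inj₂ q) = same p q

  joins-ends : ∀ {e a b c d} → Joins e a b → Joins e c d → (a ≡ c × b ≡ d) ⊎ (a ≡ d × b ≡ c)
  joins-ends (inj₁ p) (inj₁ q) with refl ← trans (sym p) q = inj₁ (refl , refl)
  joins-ends (inj₁ p) (inj₂ q) with refl ← trans (sym p) q = inj₂ (refl , refl)
  joins-ends (inj₂ p) (inj₁ q) with refl ← trans (sym p) q = inj₂ (refl , refl)
  joins-ends (inj₂ p) (inj₂ q) with refl ← trans (sym p) q = inj₁ (refl , refl)

  joining : ∀ {a b} → a ≢ b → ∃ λ e → Joins e a b
  joining {a} {b} a≢b with Fin.<-cmp a b
  ... | tri< a<b _ _ = let e , eq = present a<b in e , inj₁ eq
  ... | tri≈ _ a≡b _ = contradiction a≡b a≢b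
  ... | tri> _ _ b<a = let e , eq = present b<a in e , inj₂ eq

  joins-≢ : ∀ {e a b} → Joins e a b → a ≢ b
  joins-≢ (inj₁ p) refl = Fin.<-irrefl refl (ordered p)
  joins-≢ (inj₂ p) refl = Fin.<-irrefl refl (ordered p)

-- Walk polynomials

∑ : {A : Set} → List A → (A → ℕ) → ℕ
∑ xs f = ListAction.sum (map f xs)

module _ {A : Set} where

  ∑-mono : ∀ (xs : List A) {f g} → (∀ {x} → x ∈ˡ xs → f x ≤ g x) → ∑ xs f ≤ ∑ xs g
  ∑-mono []       _   = z≤n
  ∑-mono (x ∷ xs) f≤g = ℕ.+-mono-≤ (f≤g (here refl)) (∑-mono xs (f≤g ∘ there))

  ∑-+ : ∀ (xs : List A) f g → ∑ xs (λ x → f x + g x) ≡ ∑ xs f + ∑ xs g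
  ∑-+ []       f g = refl
  ∑-+ (x ∷ xs) f g rewrite ∑-+ xs f g = interchange ℕ.+-commutativeSemigroup (f x) (g x) (∑ xs f) (∑ xs g)

  ∑-* : ∀ (xs : List A) c f → ∑ xs (λ x → c * f x) ≡ c * ∑ xs f
  ∑-* []       c f = sym (ℕ.*-zeroʳ c)
  ∑-* (x ∷ xs) c f rewrite ∑-* xs c f = sym (ℕ.*-distribˡ-+ c (f x) (∑ xs f))

  ∑-const : ∀ (xs : List A) c → ∑ xs (λ _ → c) ≡ length xs * c
  ∑-const []       c = refl
  ∑-const (x ∷ xs) c = cong (c +_) (∑-const xs c)

  ∑-∈ : ∀ {xs : List A} f {x} → x ∈ˡ xs → f x ≤ ∑ xs f
  ∑-∈ f (here refl)            = ℕ.m≤m+n _ _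
  ∑-∈ f (there {x = y} x∈xs) = ℕ.≤-trans (∑-∈ f x∈xs) (ℕ.m≤n+m _ (f y))

  ∑-zero : ∀ {xs : List A} {f} → All (λ x → f x ≡ 0) xs → ∑ xs f ≡ 0
  ∑-zero []         = refl
  ∑-zero (eq ∷ eqs) = cong₂ _+_ eq (∑-zero eqs)

  ∑-single : ∀ {xs : List A} {f x} → Unique xs → x ∈ˡ xs → (∀ {y} → y ∈ˡ xs → y ≢ x → f y ≡ 0) → ∑ xs f ≡ f x
  ∑-single {x ∷ xs} {f} (x≢ ∷ _) (here refl) h = trans
    (cong (f x +_) (∑-zero (All.tabulate λ y∈ → h (there y∈) (λ eq → All.lookup x≢ y∈ (sym eq)))))
    (ℕ.+-identityʳ (f x))
  ∑-single (y≢ ∷ u) (there x∈) h = cong₂ _+_ (h (here refl) (All.lookup y≢ x∈)) (∑-single u x∈ (h ∘ there))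

∑-swap : {A B : Set} (xs : List A) (ys : List B) (f : A → B → ℕ) →
         ∑ xs (λ x → ∑ ys (f x)) ≡ ∑ ys (λ y → ∑ xs (λ x → f x y))
∑-swap []       ys f = sym (∑-zero (All.tabulate {xs = ys} λ _ → refl))
∑-swap (x ∷ xs) ys f = trans (cong (∑ ys (f x) +_) (∑-swap xs ys f))
  (sym (∑-+ ys (f x) (λ y → ∑ xs (λ x → f x y))))

module Exploration {n : ℕ} (N : ℕ) where

  open DecMembership (Fin._≟_ {n}) using () renaming (_∈?_ to _∈ˡ?_)

  Weight : Set
  Weight = Fin n → Fin n → ℕ

  fresh : List (Fin n) → List (Fin n)
  fresh xs = filter (λ y → ¬? (y ∈ˡ? xs)) (allFin n)

  ∈-fresh⁻ : ∀ {xs y} → y ∈ˡ fresh xs → y ∉ˡ xs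
  ∈-fresh⁻ {xs} y∈ = proj₂ (∈-filter⁻ (λ y → ¬? (y ∈ˡ? xs)) {xs = allFin n} y∈)

  ∈-fresh⁺ : ∀ {xs y} → y ∉ˡ xs → y ∈ˡ fresh xs
  ∈-fresh⁺ {xs} {y} y∉ = ∈-filter⁺ (λ y → ¬? (y ∈ˡ? xs)) (∈-allFin y) y∉

  length-fresh : ∀ xs → length (fresh xs) ≤ n
  length-fresh xs = ℕ.≤-trans (List.length-filter (λ y → ¬? (y ∈ˡ? xs)) (allFin n))
    (ℕ.≤-reflexive (List.length-tabulate (λ i → i)))

  -- For the weight N on the edges of a graph and 0 elsewhere, branch W k m xs is N ^ m times
  -- the number of ways to extend the tree on xs by k self-avoiding walks with at most m steps
  -- in all, each walk starting at a vertex visited before; walk W k m c xs counts the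
  -- continuations from inside a walk that has reached c.
  mutual
    branch : Weight → ℕ → ℕ → List (Fin n) → ℕ
    branch W zero    m xs = N ^ m
    branch W (suc k) m xs = ∑ xs (λ c → walk W k m c xs)

    walk : Weight → ℕ → ℕ → Fin n → List (Fin n) → ℕ
    walk W k zero    c xs = branch W k zero xs
    walk W k (suc m) c xs = branch W k (suc m) xs + ∑ (fresh xs) (λ y → W c y * walk W k m y (y ∷ xs))

  module _ {W W′ : Weight} where
    mutual
      -- Walks only enter vertices outside `xs`, so only those weights matter. Averaging relies on
      -- this: once a step along an offered edge has been taken, both its ends are visited and its
      -- raised weight cannot be met again.
      branch-mono : ∀ k m xs → (∀ c y → y ∉ˡ xs → W c y ≤ W′ c y) → branch W k m xs ≤ branch W′ k m xs
      branch-mono zero    m xs _ = ℕ.≤-refl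
      branch-mono (suc k) m xs h = ∑-mono xs (λ {c} _ → walk-mono k m c xs h)

      walk-mono : ∀ k m c xs → (∀ c y → y ∉ˡ xs → W c y ≤ W′ c y) → walk W k m c xs ≤ walk W′ k m c xs
      walk-mono k zero    c xs h = branch-mono k zero xs h
      walk-mono k (suc m) c xs h = ℕ.+-mono-≤ (branch-mono k (suc m) xs h)
        (∑-mono (fresh xs) λ {y} y∈ → ℕ.*-mono-≤ (h c y (∈-fresh⁻ y∈))
          (walk-mono k m y (y ∷ xs) λ c z z∉ → h c z (z∉ ∘ there)))

  -- The left case: the pair is not offered. The right case: e₀ is the offered edge joining it.
  Offered : {A : Set} → List A → (A → Weight) → Weight → Fin n → Fin n → Set
  Offered O Wₑ W c y =
      (∀ {e} → e ∈ˡ O → Wₑ e c y ≤ W c y)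
    ⊎ ∃ λ e₀ → e₀ ∈ˡ O × (∀ {e} → e ∈ˡ O → e ≢ e₀ → Wₑ e c y ≡ 0) × Wₑ e₀ c y ≤ N * W c y
             × (∀ d z → z ≢ c → z ≢ y → Wₑ e₀ d z ≤ W d z)

  module _ {A : Set} {O : List A} (unique : Unique O) (∣O∣≤N : length O ≤ N)
           {Wₑ : A → Weight} {W : Weight} (offered : ∀ c y → c ≢ y → Offered O Wₑ W c y) where

    -- Every monomial of branch is multilinear in the weights, because each step of a
    -- walk enters a new vertex; this is why its average over the offer does not grow.
    mutual
      branch-average : ∀ k m xs → ∑ O (λ e → branch (Wₑ e) k m xs) ≤ N * branch W k m xs
      branch-average zero    m xs = subst (_≤ N * N ^ m) (sym (∑-const O (N ^ m))) (ℕ.*-monoˡ-≤ (N ^ m) ∣O∣≤N)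
      branch-average (suc k) m xs = begin
        ∑ O (λ e → ∑ xs (λ c → walk (Wₑ e) k m c xs)) ≡⟨ ∑-swap O xs _ ⟩
        ∑ xs (λ c → ∑ O (λ e → walk (Wₑ e) k m c xs)) ≤⟨ ∑-mono xs (λ {c} c∈ → walk-average k m c xs c∈) ⟩
        ∑ xs (λ c → N * walk W k m c xs)               ≡⟨ ∑-* xs N _ ⟩
        N * branch W (suc k) m xs                      ∎
        where open ℕ.≤-Reasoning hiding (start)

      walk-average : ∀ k m c xs → c ∈ˡ xs → ∑ O (λ e → walk (Wₑ e) k m c xs) ≤ N * walk W k m c xs
      walk-average k zero    c xs c∈ = branch-average k zero xs
      walk-average k (suc m) c xs c∈ = begin
        ∑ O (λ e → branch (Wₑ e) k (suc m) xs + ∑ (fresh xs) (λ y → step e y))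
          ≡⟨ ∑-+ O _ _ ⟩
        ∑ O (λ e → branch (Wₑ e) k (suc m) xs) + ∑ O (λ e → ∑ (fresh xs) (step e))
          ≤⟨ ℕ.+-mono-≤ (branch-average k (suc m) xs) steps ⟩
        N * branch W k (suc m) xs + N * ∑ (fresh xs) (λ y → W c y * walk W k m y (y ∷ xs))
          ≡⟨ ℕ.*-distribˡ-+ N (branch W k (suc m) xs) _ ⟨
        N * walk W k (suc m) c xs ∎
        where
        open ℕ.≤-Reasoning hiding (start)
        step : A → Fin n → ℕ
        step e y = Wₑ e c y * walk (Wₑ e) k m y (y ∷ xs)
        at : ∀ {y} → y ∉ˡ xs → Offered O Wₑ W c y → ∑ O (λ e → step e y) ≤ N * (W c y * walk W k m y (y ∷ xs))
        at {y} y∉ (inj₁ unoffered) = begin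
          ∑ O (λ e → step e y)                             ≤⟨ ∑-mono O (λ e∈ → ℕ.*-monoˡ-≤ _ (unoffered e∈)) ⟩
          ∑ O (λ e → W c y * walk (Wₑ e) k m y (y ∷ xs)) ≡⟨ ∑-* O (W c y) _ ⟩
          W c y * ∑ O (λ e → walk (Wₑ e) k m y (y ∷ xs)) ≤⟨ ℕ.*-monoʳ-≤ (W c y) (walk-average k m y (y ∷ xs) (here refl)) ⟩
          W c y * (N * walk W k m y (y ∷ xs))              ≡⟨ x∙yz≈y∙xz ℕ.*-commutativeSemigroup (W c y) N _ ⟩
          N * (W c y * walk W k m y (y ∷ xs))              ∎
        -- Every answer other than `e₀` makes this step vanish. The answer `e₀` raises its weight by
        -- a factor of at most `N`, which is the factor allowed for the sum over the offer.
        at {y} y∉ (inj₂ (e₀ , e₀∈ , zeros , scaled , below)) = begin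
          ∑ O (λ e → step e y)                ≡⟨ ∑-single unique e₀∈ (λ {e} e∈ e≢ → cong (_* walk (Wₑ e) k m y (y ∷ xs)) (zeros e∈ e≢)) ⟩
          step e₀ y                           ≤⟨ ℕ.*-mono-≤ scaled (walk-mono k m y (y ∷ xs) λ d z z∉ →
                                                   below d z (λ { refl → z∉ (there c∈) }) (λ { refl → z∉ (here refl) })) ⟩
          N * W c y * walk W k m y (y ∷ xs)   ≡⟨ ℕ.*-assoc N _ _ ⟩
          N * (W c y * walk W k m y (y ∷ xs)) ∎
        steps : ∑ O (λ e → ∑ (fresh xs) (step e)) ≤ N * ∑ (fresh xs) (λ y → W c y * walk W k m y (y ∷ xs))
        steps = begin
          ∑ O (λ e → ∑ (fresh xs) (step e))        ≡⟨ ∑-swap O (fresh xs) step ⟩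
          ∑ (fresh xs) (λ y → ∑ O (λ e → step e y)) ≤⟨ ∑-mono (fresh xs) (λ {y} y∈ →
                                                         at (∈-fresh⁻ y∈) (offered c y (λ { refl → ∈-fresh⁻ y∈ c∈ }))) ⟩
          ∑ (fresh xs) (λ y → N * (W c y * walk W k m y (y ∷ xs))) ≡⟨ ∑-* (fresh xs) N _ ⟩
          N * ∑ (fresh xs) (λ y → W c y * walk W k m y (y ∷ xs)) ∎

  -- Lower bound for the walk polynomials.

  module _ {W : Weight} where

    -- The part of walk in which the current walk ends at u.
    walkTo : ℕ → ℕ → Fin n → List (Fin n) → Fin n → ℕ
    walkTo k zero    c xs u = if does (c Fin.≟ u) then branch W k zero xs else 0
    walkTo k (suc m) c xs u = (if does (c Fin.≟ u) then branch W k (suc m) xs else 0)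
                            + ∑ (fresh xs) (λ y → W c y * walkTo k m y (y ∷ xs) u)

    private
      ∑-indicator : ∀ {us : List (Fin n)} c x → Unique us → ∑ us (λ u → if does (c Fin.≟ u) then x else 0) ≤ x
      ∑-indicator {[]}     c x _ = z≤n
      ∑-indicator {u ∷ us} c x (u≢ ∷ un) with c Fin.≟ u
      ... | no  _    = ∑-indicator c x un
      ... | yes refl = ℕ.≤-reflexive (trans (cong (x +_) (∑-zero (All.map miss u≢))) (ℕ.+-identityʳ x))
        where
        miss : ∀ {v} → c ≢ v → (if does (c Fin.≟ v) then x else 0) ≡ 0
        miss {v} c≢v with c Fin.≟ v
        ... | yes eq = contradiction eq c≢v
        ... | no  _  = refl

    -- A walk has only one last vertex, so different prescribed ends count different walks.
    ∑-walkTo : ∀ {us} → Unique us → ∀ k m c xs → ∑ us (walkTo k m c xs) ≤ walk W k m c xs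
    ∑-walkTo un k zero    c xs = ∑-indicator c (branch W k zero xs) un
    ∑-walkTo {us} un k (suc m) c xs = begin
      ∑ us (walkTo k (suc m) c xs)
        ≡⟨ ∑-+ us (λ u → if does (c Fin.≟ u) then branch W k (suc m) xs else 0) _ ⟩
      ∑ us (λ u → if does (c Fin.≟ u) then branch W k (suc m) xs else 0)
        + ∑ us (λ u → ∑ (fresh xs) (λ y → W c y * walkTo k m y (y ∷ xs) u))
        ≤⟨ ℕ.+-mono-≤ (∑-indicator c (branch W k (suc m) xs) un) steps ⟩
      walk W k (suc m) c xs ∎
      where
      open ℕ.≤-Reasoning hiding (start)
      steps : ∑ us (λ u → ∑ (fresh xs) (λ y → W c y * walkTo k m y (y ∷ xs) u))
              ≤ ∑ (fresh xs) (λ y → W c y * walk W k m y (y ∷ xs))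
      steps = begin
        ∑ us (λ u → ∑ (fresh xs) (λ y → W c y * walkTo k m y (y ∷ xs) u))
          ≡⟨ ∑-swap us (fresh xs) _ ⟩
        ∑ (fresh xs) (λ y → ∑ us (λ u → W c y * walkTo k m y (y ∷ xs) u))
          ≤⟨ ∑-mono (fresh xs) (λ {y} _ → ℕ.≤-trans (ℕ.≤-reflexive (∑-* us (W c y) _))
               (ℕ.*-monoʳ-≤ (W c y) (∑-walkTo un k m y (y ∷ xs)))) ⟩
        ∑ (fresh xs) (λ y → W c y * walk W k m y (y ∷ xs)) ∎

  module _ (G : Graph n) where

    data Path (xs : List (Fin n)) (c : Fin n) : Fin n → Set where
      stop : Path xs c c
      step : ∀ {y u} → y ∉ˡ xs → SymClosure (Adjacent G) c y → Path (y ∷ xs) y u → Path xs c u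

    private
      forget : ∀ {xs ys c u} → (∀ {x} → x ∈ˡ ys → x ∈ˡ xs) → Path xs c u → Path ys c u
      forget ys⊆xs stop             = stop
      forget ys⊆xs (step y∉ adj p) = step (y∉ ∘ ys⊆xs) adj
        (forget (λ { (here eq) → here eq ; (there x∈) → there (ys⊆xs x∈) }) p)

    -- Dropping what precedes the last visit to `xs`, and all loops, leaves a self-avoiding walk
    -- that starts in the tree. Hence every vertex of the component is a possible end of the next
    -- walk.
    connected⇒path : ∀ {xs c u} → c ∈ˡ xs → Connected G c u → ∃ λ d → d ∈ˡ xs × Path xs d u
    connected⇒path c∈ stay = _ , c∈ , stop
    connected⇒path {xs} {c} c∈ (_◅_ {j = y} adj rest) with y ∈ˡ? xs
    ... | yes y∈ = connected⇒path y∈ rest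
    ... | no  y∉ with connected⇒path {y ∷ xs} (here refl) rest
    ...   | d , there d∈ , p   = d , d∈ , forget there p
    ...   | _ , here refl , p  = c , c∈ , step y∉ adj p

    module _ {W : Weight} (heavy : ∀ {c y} → SymClosure (Adjacent G) c y → c ≢ y → N ≤ W c y) (v : Fin n) where

      private
        C = elements (component G v)

        reached : ∀ {u} → u ∈ˡ C → Connected G v u
        reached u∈ = ∈-subset⁻ (connected? G v) (∈-elements⁻ u∈)

        room : ∀ {xs y} → Unique xs → y ∉ˡ xs → length xs < n
        room {xs} {y} un y∉ = ℕ.≤-trans
          (unique⇒length≤∣p∣ {m = n} {p = ⊤} {y ∷ xs}
            (All.tabulate (λ { x∈ refl → y∉ x∈ }) ∷ un) (All.tabulate λ _ → ∈⊤))
          (ℕ.≤-reflexive (∣⊤∣≡n n))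

        B : ℕ → ℕ → ℕ
        B k m = N ^ m * length C ^ k

        indicator : ∀ (c : Fin n) x → x ≤ (if does (c Fin.≟ c) then x else 0)
        indicator c x with c Fin.≟ c
        ... | yes _ = ℕ.≤-refl
        ... | no ¬p = contradiction refl ¬p

      mutual
        -- Each of the `k` walks may end at any vertex of the component, which gives the factor
        -- `length C` per walk. The equation `m + length xs ≡ n` leaves as many steps as there are
        -- unvisited vertices, so the budget cannot run out along a path.
        branch-lower : ∀ k m {xs c} → Unique xs → c ∈ˡ xs → All (Connected G v) xs → m + length xs ≡ n →
                       B k m ≤ branch W k m xs
        branch-lower zero    m un c∈ conn eq = ℕ.≤-reflexive (ℕ.*-identityʳ (N ^ m))
        branch-lower (suc k) m {xs} un c∈ conn eq = begin
          B (suc k) m                             ≡⟨ x∙yz≈y∙xz ℕ.*-commutativeSemigroup (N ^ m) (length C) (length C ^ k) ⟩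
          length C * B k m                        ≡⟨ ∑-const C (B k m) ⟨
          ∑ C (λ _ → B k m)                       ≤⟨ ∑-mono C (λ u∈ → toC u∈) ⟩
          ∑ C (λ u → ∑ xs (λ d → walkTo {W} k m d xs u)) ≡⟨ ∑-swap C xs _ ⟩
          ∑ xs (λ d → ∑ C (walkTo {W} k m d xs))      ≤⟨ ∑-mono xs (λ {d} _ → ∑-walkTo (elements-unique _) k m d xs) ⟩
          branch W (suc k) m xs ∎
          where
          open ℕ.≤-Reasoning hiding (start)
          toC : ∀ {u} → u ∈ˡ C → B k m ≤ ∑ xs (λ d → walkTo {W} k m d xs u)
          toC {u} u∈ with connected⇒path c∈ (Eq.symmetric _ (All.lookup conn c∈) ◅◅ reached u∈)
          ... | d , d∈ , p = ℕ.≤-trans (walkTo-lower k m un d∈ conn eq p) (∑-∈ (λ d → walkTo {W} k m d xs u) d∈)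

        walkTo-lower : ∀ k m {xs c u} → Unique xs → c ∈ˡ xs → All (Connected G v) xs → m + length xs ≡ n →
                       Path xs c u → B k m ≤ walkTo {W} k m c xs u
        walkTo-lower k zero {xs} {c} un c∈ conn eq stop =
          ℕ.≤-trans (branch-lower k zero un c∈ conn eq) (indicator c (branch W k zero xs))
        walkTo-lower k (suc m) {xs} {c} un c∈ conn eq stop = ℕ.m≤n⇒m≤n+o
          (∑ (fresh xs) (λ y → W c y * walkTo {W} k m y (y ∷ xs) c))
          (ℕ.≤-trans (branch-lower k (suc m) un c∈ conn eq) (indicator c (branch W k (suc m) xs)))
        walkTo-lower k zero {xs} un c∈ conn eq (step y∉ adj p) = contradiction eq (ℕ.<⇒≢ (room un y∉))
        walkTo-lower k (suc m) {xs} {c} {u} un c∈ conn eq (step {y = y} y∉ adj p) = begin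
          B k (suc m)                          ≡⟨ ℕ.*-assoc N (N ^ m) _ ⟩
          N * B k m                            ≤⟨ ℕ.*-mono-≤ (heavy adj (λ { refl → y∉ c∈ }))
                                                    (walkTo-lower k m (All.tabulate (λ { x∈ refl → y∉ x∈ }) ∷ un)
                                                      (here refl) ((All.lookup conn c∈ ◅◅ (adj ◅ stay)) ∷ conn)
                                                      (trans (ℕ.+-suc m _) eq) p) ⟩
          W c y * walkTo {W} k m y (y ∷ xs) u      ≤⟨ ∑-∈ (λ y → W c y * walkTo {W} k m y (y ∷ xs) u) (∈-fresh⁺ y∉) ⟩
          ∑ (fresh xs) (λ y → W c y * walkTo {W} k m y (y ∷ xs) u) ≤⟨ ℕ.m≤n+m _ _ ⟩
          walkTo {W} k (suc m) c xs u ∎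
          where open ℕ.≤-Reasoning hiding (start)

-- Client's potential

^-distribʳ-* : ∀ k a b → (a * b) ^ k ≡ a ^ k * b ^ k
^-distribʳ-* zero    a b = refl
^-distribʳ-* (suc k) a b rewrite ^-distribʳ-* k a b = interchange ℕ.*-commutativeSemigroup a b (a ^ k) (b ^ k)

-- Bernoulli's inequality `(1 - 1/(x+1))^k ≥ 1 - k/(x+1)`, multiplied by `(x+1)^(k+1)` to stay
-- within the natural numbers.
bernoulli : ∀ x k → suc x ^ k * suc x ≤ x ^ k * suc x + k * suc x ^ k
bernoulli x zero    = ℕ.≤-reflexive (sym (ℕ.+-identityʳ _))
bernoulli x (suc k) = begin
  suc x * y * suc x                           ≡⟨ expand x y ⟩
  x * (y * suc x) + y * suc x                 ≤⟨ ℕ.+-monoˡ-≤ (y * suc x) (ℕ.*-monoʳ-≤ x (bernoulli x k)) ⟩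
  x * (z * suc x + k * y) + y * suc x         ≤⟨ ℕ.m≤m+n _ (k * y) ⟩
  x * (z * suc x + k * y) + y * suc x + k * y ≡⟨ collect x y z k ⟩
  x * z * suc x + suc k * (suc x * y) ∎
  where
  open ℕ.≤-Reasoning hiding (start)
  y = suc x ^ k
  z = x ^ k
  expand : ∀ x y → suc x * y * suc x ≡ x * (y * suc x) + y * suc x
  expand = solve-∀
  collect : ∀ x y z k → x * (z * suc x + k * y) + y * suc x + k * y ≡ x * z * suc x + suc k * (suc x * y)
  collect = solve-∀

-- Here `k/(x+1)` is at most `1/(D+1)`, so Bernoulli bounds `(x/(x+1))^k` below by `D/(D+1)`.
power-growth : ∀ D k x → suc D * k ≤ suc x → D * suc x ^ k ≤ suc D * x ^ k
power-growth D k x small = ℕ.*-cancelʳ-≤ _ _ (suc x) (ℕ.+-cancelʳ-≤ (suc x * y) _ _ (begin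
  D * y * suc x + suc x * y       ≡⟨ rearrange₁ D y x ⟩
  suc D * (y * suc x)             ≤⟨ ℕ.*-monoʳ-≤ (suc D) (bernoulli x k) ⟩
  suc D * (z * suc x + k * y)     ≡⟨ rearrange₂ D y z x k ⟩
  suc D * z * suc x + suc D * k * y ≤⟨ ℕ.+-monoʳ-≤ _ (ℕ.*-monoˡ-≤ y small) ⟩
  suc D * z * suc x + suc x * y ∎))
  where
  open ℕ.≤-Reasoning hiding (start)
  y = suc x ^ k
  z = x ^ k
  rearrange₁ : ∀ D y x → D * y * suc x + suc x * y ≡ suc D * (y * suc x)
  rearrange₁ = solve-∀
  rearrange₂ : ∀ D y z x k → suc D * (z * suc x + k * y) ≡ suc D * z * suc x + suc D * k * y
  rearrange₂ = solve-∀

-- H and A are chosen so that N ^ m * (H ^ suc k * (length xs + A) ^ k) is a supersolution of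
-- the recursion for walk with weights at most 1: the ratio N / n ≥ 1 + 1/E outweighs the
-- growth of (length xs + A) ^ k in one step.
module Upper {n N : ℕ} (E K : ℕ) (spread : n * suc E ≤ N * E) where

  open Exploration {n} N

  H A : ℕ
  H = 2 * E + 2
  A = (2 * E + 1) * K

  private
    -- For `E > 0`, `spread` says that `N/n` is at least `(2E+2)/(2E)`, while the power grows by a
    -- factor of at most `(2E+1)/(2E)`. The product leaves the factor `(H-1)/H`. The summand `A`
    -- makes `small` hold for every tree.
    scale-step : ∀ x k → (2 * E + 1) * k ≤ suc x → H * (n * suc x ^ k) ≤ (2 * E + 1) * (N * x ^ k)
    scale-step x k small = begin
      H * (n * suc x ^ k)               ≡⟨ rearrange₁ E n (suc x ^ k) ⟩
      2 * (n * suc E) * suc x ^ k       ≤⟨ ℕ.*-monoˡ-≤ (suc x ^ k) (ℕ.*-monoʳ-≤ 2 spread) ⟩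
      2 * (N * E) * suc x ^ k           ≡⟨ rearrange₂ E N (suc x ^ k) ⟩
      N * (2 * E * suc x ^ k)           ≤⟨ ℕ.*-monoʳ-≤ N (power-growth (2 * E) k x (subst (λ z → z * k ≤ suc x) (ℕ.+-comm (2 * E) 1) small)) ⟩
      N * (suc (2 * E) * x ^ k)         ≡⟨ rearrange₃ E N (x ^ k) ⟩
      (2 * E + 1) * (N * x ^ k) ∎
      where
      open ℕ.≤-Reasoning hiding (start)
      rearrange₁ : ∀ E n y → (2 * E + 2) * (n * y) ≡ 2 * (n * suc E) * y
      rearrange₁ = solve-∀
      rearrange₂ : ∀ E N y → 2 * (N * E) * y ≡ N * (2 * E * y)
      rearrange₂ = solve-∀
      rearrange₃ : ∀ E N y → N * (suc (2 * E) * y) ≡ (2 * E + 1) * (N * y)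
      rearrange₃ = solve-∀

    1≤H : 1 ≤ H
    1≤H = ℕ.≤-trans (s≤s z≤n) (ℕ.m≤n+m 2 (2 * E))

  module _ {W : Weight} (light : ∀ c y → W c y ≤ 1) where
    mutual
      -- The bound for `branch` is smaller than the one for `walk` by the factor `H`. In
      -- `walk-upper`, stopping the walk therefore costs one `H`-th of the bound, and by
      -- `scale-step` going on costs at most the other `H - 1` parts.
      branch-upper : ∀ k m xs → k ≤ K → H * branch W k m xs ≤ N ^ m * (H ^ suc k * (length xs + A) ^ k)
      branch-upper zero    m xs _ = ℕ.≤-reflexive (rearrange₁ H (N ^ m))
        where
        rearrange₁ : ∀ H y → H * y ≡ y * (H * 1 * 1)
        rearrange₁ = solve-∀
      branch-upper (suc k) m xs k<K = begin
        H * branch W (suc k) m xs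
          ≤⟨ ℕ.*-monoʳ-≤ H (∑-mono xs λ {c} _ → walk-upper k m c xs (ℕ.<⇒≤ k<K)) ⟩
        H * ∑ xs (λ _ → Z)      ≡⟨ cong (H *_) (∑-const xs Z) ⟩
        H * (length xs * Z)     ≤⟨ ℕ.*-monoʳ-≤ H (ℕ.*-monoˡ-≤ Z (ℕ.m≤m+n (length xs) A)) ⟩
        H * ((length xs + A) * Z) ≡⟨ rearrange₁ H (length xs + A) (N ^ m) (H ^ suc k) ((length xs + A) ^ k) ⟩
        N ^ m * (H ^ suc (suc k) * (length xs + A) ^ suc k) ∎
        where
        open ℕ.≤-Reasoning hiding (start)
        Z = N ^ m * (H ^ suc k * (length xs + A) ^ k)
        rearrange₁ : ∀ H x a b c → H * (x * (a * (b * c))) ≡ a * ((H * b) * (x * c))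
        rearrange₁ = solve-∀

      walk-upper : ∀ k m c xs → k ≤ K → walk W k m c xs ≤ N ^ m * (H ^ suc k * (length xs + A) ^ k)
      walk-upper k zero    c xs k≤K = ℕ.≤-trans (ℕ.m≤n*m (branch W k 0 xs) H {{ℕ.>-nonZero 1≤H}}) (branch-upper k 0 xs k≤K)
      walk-upper k (suc m) c xs k≤K = ℕ.*-cancelˡ-≤ H {{ℕ.>-nonZero 1≤H}} (begin
        H * (branch W k (suc m) xs + ∑ (fresh xs) (λ y → W c y * walk W k m y (y ∷ xs)))
          ≡⟨ ℕ.*-distribˡ-+ H (branch W k (suc m) xs) _ ⟩
        H * branch W k (suc m) xs + H * ∑ (fresh xs) (λ y → W c y * walk W k m y (y ∷ xs))
          ≤⟨ ℕ.+-mono-≤ (branch-upper k (suc m) xs k≤K) (ℕ.*-monoʳ-≤ H steps) ⟩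
        N * N ^ m * (H ^ suc k * x ^ k) + H * (n * (N ^ m * (H ^ suc k * suc x ^ k)))
          ≡⟨ cong (N * N ^ m * (H ^ suc k * x ^ k) +_) (rearrange₁ H n (N ^ m) (H ^ suc k) (suc x ^ k)) ⟩
        N * N ^ m * (H ^ suc k * x ^ k) + N ^ m * H ^ suc k * (H * (n * suc x ^ k))
          ≤⟨ ℕ.+-monoʳ-≤ (N * N ^ m * (H ^ suc k * x ^ k)) (ℕ.*-monoʳ-≤ (N ^ m * H ^ suc k) (scale-step x k (ℕ.≤-trans
               (ℕ.*-monoʳ-≤ (2 * E + 1) k≤K) (ℕ.m≤n⇒m≤1+n (ℕ.m≤n+m A (length xs)))))) ⟩
        N * N ^ m * (H ^ suc k * x ^ k) + N ^ m * H ^ suc k * ((2 * E + 1) * (N * x ^ k))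
          ≡⟨ rearrange₂ E N (N ^ m) (H ^ suc k) (x ^ k) ⟩
        H * (N ^ suc m * (H ^ suc k * x ^ k)) ∎)
        where
        open ℕ.≤-Reasoning hiding (start)
        x = length xs + A
        rearrange₁ : ∀ H n a b c → H * (n * (a * (b * c))) ≡ a * b * (H * (n * c))
        rearrange₁ = solve-∀
        rearrange₂ : ∀ E N a b c → N * a * (b * c) + a * b * ((2 * E + 1) * (N * c)) ≡ (2 * E + 2) * (N * a * (b * c))
        rearrange₂ = solve-∀
        steps : ∑ (fresh xs) (λ y → W c y * walk W k m y (y ∷ xs)) ≤ n * (N ^ m * (H ^ suc k * suc x ^ k))
        steps = begin
          ∑ (fresh xs) (λ y → W c y * walk W k m y (y ∷ xs))
            ≤⟨ ∑-mono (fresh xs) (λ {y} _ → ℕ.≤-trans (ℕ.*-monoˡ-≤ _ (light c y))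
                 (ℕ.≤-trans (ℕ.≤-reflexive (ℕ.*-identityˡ _)) (walk-upper k m y (y ∷ xs) k≤K))) ⟩
          ∑ (fresh xs) (λ _ → N ^ m * (H ^ suc k * suc x ^ k)) ≡⟨ ∑-const (fresh xs) _ ⟩
          length (fresh xs) * (N ^ m * (H ^ suc k * suc x ^ k)) ≤⟨ ℕ.*-monoˡ-≤ _ (length-fresh xs) ⟩
          n * (N ^ m * (H ^ suc k * suc x ^ k)) ∎

-- The potential of a position and Client's answers.

module ClientSide (n′ q K : ℕ) where

  private
    n N : ℕ
    n = suc n′
    N = suc q

  open Exploration {n} N
  open DecMembership (Fin._≟_ {length (edges n)}) using () renaming (_∈?_ to _∈ˡ?_)

  status : Position n → Edge n → ℕ
  status p e with e ∈ˡ? client p | e ∈? free p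
  ... | yes _ | _     = N
  ... | no  _ | yes _ = 1
  ... | no  _ | no  _ = 0

  weight : Position n → Weight
  weight p c y with c Fin.≟ y
  ... | yes _  = 0
  ... | no c≢y = status p (proj₁ (joining c≢y))

  -- The budget `n′` counts the vertices other than the root, and every step of the `K` walks
  -- together enters a new one of them.
  potential : Position n → ℕ
  potential p = ∑ (allFin n) (λ v → branch (weight p) K n′ (v ∷ []))

  -- `Position` by itself allows a free edge to be Client's already; such an edge would keep the
  -- weight `N` after being refused.
  Disjoint : Position n → Set
  Disjoint p = ∀ {e} → e ∈ˡ client p → e ∉ free p

  claim-disjoint : ∀ {p O e} → Disjoint p → e ∈ O → Disjoint (claim p O e)
  claim-disjoint {p} {O} disjoint e∈O (here refl) f = x∈p─q⇒x∉q {p = free p} f e∈O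
  claim-disjoint {p} {O} disjoint e∈O (there c)   f = disjoint c (p─q⊆p (free p) O f)

  status-mono : ∀ {p p′ e} → (e ∈ˡ client p → e ∈ˡ client p′) → (e ∈ free p → e ∈ free p′) → status p e ≤ status p′ e
  status-mono {p} {p′} {e} cl fr with e ∈ˡ? client p | e ∈? free p | e ∈ˡ? client p′ | e ∈? free p′
  ... | yes _ | _     | yes _ | _     = ℕ.≤-refl
  ... | yes c | _     | no ¬c | _     = contradiction (cl c) ¬c
  ... | no _  | no _  | _     | _     = z≤n
  ... | no _  | yes _ | yes _ | _     = s≤s z≤n
  ... | no _  | yes _ | no _  | yes _ = ℕ.≤-refl
  ... | no _  | yes f | no _  | no ¬f = contradiction (fr f) ¬f

  status-client : ∀ {p e} → e ∈ˡ client p → status p e ≡ N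
  status-client {p} {e} c with e ∈ˡ? client p | e ∈? free p
  ... | yes _ | _ = refl
  ... | no ¬c | _ = contradiction c ¬c

  status-waiter : ∀ {p e} → e ∉ˡ client p → e ∉ free p → status p e ≡ 0
  status-waiter {p} {e} ¬c ¬f with e ∈ˡ? client p | e ∈? free p
  ... | yes c | _     = contradiction c ¬c
  ... | no  _ | yes f = contradiction f ¬f
  ... | no  _ | no  _ = refl

  status-free : ∀ {p e} → e ∈ free p → 1 ≤ status p e
  status-free {p} {e} f with e ∈ˡ? client p | e ∈? free p
  ... | yes _ | _     = s≤s z≤n
  ... | no  _ | yes _ = ℕ.≤-refl
  ... | no  _ | no ¬f = contradiction f ¬f

  status≤N : ∀ p e → status p e ≤ N
  status≤N p e with e ∈ˡ? client p | e ∈? free p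
  ... | yes _ | _     = ℕ.≤-refl
  ... | no  _ | yes _ = s≤s z≤n
  ... | no  _ | no  _ = z≤n

  weight-mono : ∀ {p p′ c y} → (∀ {e} → Joins e c y → status p e ≤ status p′ e) → weight p c y ≤ weight p′ c y
  weight-mono {p} {p′} {c} {y} h with c Fin.≟ y
  ... | yes _  = z≤n
  ... | no c≢y = h (proj₂ (joining c≢y))

  weight-joins : ∀ {p e c y} → Joins e c y → weight p c y ≡ status p e
  weight-joins {p} {e} {c} {y} j with c Fin.≟ y
  ... | yes eq = contradiction eq (joins-≢ j)
  ... | no c≢y = cong (status p) (joins-unique (proj₂ (joining c≢y)) j)

  potential-mono : ∀ {p p′} → (∀ e → status p e ≤ status p′ e) → potential p ≤ potential p′
  potential-mono {p} {p′} h = ∑-mono (allFin n) λ {v} _ → branch-mono K n′ (v ∷ []) λ c y _ →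
    weight-mono {p} {p′} {c} {y} (λ {e} _ → h e)

  module _ (p : Position n) (disjoint : Disjoint p) {O : EdgeSet n} (legal : IsOffer q p O) where

    private
      O⊆ = proj₁ legal

      unoffered : ∀ {e f} → e ∈ O → f ∉ O → status (claim p O e) f ≤ status p f
      unoffered {e} {f} e∈O f∉O = status-mono {claim p O e} {p}
        (λ { (here refl) → contradiction e∈O f∉O ; (there c) → c })
        (p─q⊆p (free p) O)

      refused : ∀ {e f} → f ∈ O → e ≢ f → status (claim p O e) f ≡ 0
      refused {e} {f} f∈O e≢f = status-waiter {claim p O e}
        (λ { (here refl) → e≢f refl ; (there c) → disjoint c (O⊆ f∈O) })
        (λ f∈ → x∈p─q⇒x∉q {p = free p} f∈ f∈O)

      others : ∀ {e f} → e ∈ O → f ≢ e → status (claim p O e) f ≤ status p f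
      others {e} {f} e∈O f≢e with f ∈? O
      ... | no f∉O  = unoffered e∈O f∉O
      ... | yes f∈O = ℕ.≤-trans (ℕ.≤-reflexive (refused f∈O (f≢e ∘ sym))) z≤n

    offered : ∀ c y → c ≢ y → Offered (elements O) (λ e → weight (claim p O e)) (weight p) c y
    offered c y c≢y with joining c≢y
    ... | f , j with f ∈? O
    ...   | no f∉O  = inj₁ λ {e} e∈ → subst₂ _≤_ (sym (weight-joins {claim p O e} j)) (sym (weight-joins {p} j))
                        (unoffered (∈-elements⁻ e∈) f∉O)
    ...   | yes f∈O = inj₂ (f , ∈-elements⁺ f∈O
        , (λ {e} e∈ e≢f → trans (weight-joins {claim p O e} j) (refused f∈O e≢f))
        -- An offered edge is free, so its old weight is at least 1, and `N` times that covers the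
        -- new weight.
        , ℕ.≤-trans (ℕ.≤-trans (ℕ.≤-reflexive (weight-joins {claim p O f} j)) (status≤N (claim p O f) f))
            (ℕ.m≤m*n N (weight p c y) {{ℕ.>-nonZero (subst (1 ≤_) (sym (weight-joins {p} j)) (status-free {p} (O⊆ f∈O)))}})
        , λ d z z≢c z≢y → weight-mono {claim p O f} {p} {d} {z} λ {g} jg → others f∈O λ { refl → clash z≢c z≢y (joins-ends j jg) })
      where
      clash : ∀ {d z} → z ≢ c → z ≢ y → ¬ ((c ≡ d × y ≡ z) ⊎ (c ≡ z × y ≡ d))
      clash z≢c z≢y (inj₁ (_ , eq)) = z≢y (sym eq)
      clash z≢c z≢y (inj₂ (eq , _)) = z≢c (sym eq)

    potential-average : ∑ (elements O) (λ e → potential (claim p O e)) ≤ N * potential p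
    potential-average = begin
      ∑ (elements O) (λ e → potential (claim p O e))
        ≡⟨ ∑-swap (elements O) (allFin n) _ ⟩
      ∑ (allFin n) (λ v → ∑ (elements O) (λ e → branch (weight (claim p O e)) K n′ (v ∷ [])))
        ≤⟨ ∑-mono (allFin n) (λ {v} _ → branch-average (elements-unique O)
             (ℕ.≤-reflexive (trans (length-elements O) (proj₂ legal))) offered K n′ (v ∷ [])) ⟩
      ∑ (allFin n) (λ v → N * branch (weight p) K n′ (v ∷ []))
        ≡⟨ ∑-* (allFin n) N _ ⟩
      N * potential p ∎
      where open ℕ.≤-Reasoning hiding (start)

    -- The least of the `N` new potentials is at most their average.
    safe-choice : ∃ λ e → e ∈ O × potential (claim p O e) ≤ potential p
    safe-choice with minimiser (λ e → potential (claim p O e)) (elements O) (∈-elements⁺ (proj₂ (nonempty O (proj₂ legal))))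
    ... | e , e∈ , best = e , ∈-elements⁻ e∈ , ℕ.*-cancelˡ-≤ N (begin
      N * potential (claim p O e)                        ≡⟨ cong (_* potential (claim p O e)) (trans (length-elements O) (proj₂ legal)) ⟨
      length (elements O) * potential (claim p O e)      ≡⟨ ∑-const (elements O) _ ⟨
      ∑ (elements O) (λ _ → potential (claim p O e))     ≤⟨ ∑-mono (elements O) (λ e′∈ → All.lookup best e′∈) ⟩
      ∑ (elements O) (λ e′ → potential (claim p O e′))   ≤⟨ potential-average ⟩
      N * potential p ∎)
      where open ℕ.≤-Reasoning hiding (start)

  potential-lower : ∀ p v → N ^ n′ * ∣ component (clientGraph p) v ∣ ^ K ≤ potential p
  potential-lower p v = ℕ.≤-trans
    (subst (λ s → N ^ n′ * s ^ K ≤ branch (weight p) K n′ (v ∷ [])) (length-elements (component (clientGraph p) v))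
      (branch-lower (clientGraph p) {weight p} heavy v K n′ ([] ∷ []) (here refl)
        (stay ∷ []) (ℕ.+-comm n′ 1)))
    (∑-∈ (λ v → branch (weight p) K n′ (v ∷ [])) (∈-allFin v))
    where
    heavy : ∀ {c y} → SymClosure (Adjacent (clientGraph p)) c y → c ≢ y → N ≤ weight p c y
    heavy (fwd adj) _ with ∈-map⁻ (lookup (edges n)) adj
    ... | e , e∈ , eq = ℕ.≤-reflexive (sym (trans (weight-joins {p} {e} (inj₁ (sym eq))) (status-client {p} e∈)))
    heavy (bwd adj) _ with ∈-map⁻ (lookup (edges n)) adj
    ... | e , e∈ , eq = ℕ.≤-reflexive (sym (trans (weight-joins {p} {e} (inj₂ (sym eq))) (status-client {p} e∈)))

  module _ {B S : ℕ} (enough : ∀ s → N ^ n′ * s ^ K ≤ B → s ≤ S) where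

    -- The bound `B` is an invariant: a safe choice keeps it, and `finish` only lowers weights. At
    -- the end of the game `potential-lower` converts it into a bound on every component.
    value-upper : ∀ k p → Disjoint p → potential p ≤ B → value q k p ≤ S
    value-upper zero p _ ≤B = max≤v⁺ {xs = map (λ v → ∣ component (clientGraph p) v ∣) (allFin n)} z≤n
      (All.map⁺ (All.tabulate λ {v} _ → enough _ (ℕ.≤-trans (potential-lower p v) ≤B)))
    value-upper (suc k) p disjoint ≤B with suc q ℕ.≤? ∣ free p ∣
    ... | no _  = value-upper k (finish p) (λ _ → ∉⊥)
      (ℕ.≤-trans (potential-mono {finish p} {p} λ e → status-mono {finish p} {p} {e} (λ c → c) (λ f → contradiction f ∉⊥)) ≤B)
    ... | yes _ = max≤v⁺ {xs = map (offerValue q k p) (offers q p)} z≤n (All.map⁺ (All.tabulate bound))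
      where
      bound : ∀ {O} → O ∈ˡ offers q p → offerValue q k p O ≤ S
      bound {O} O∈ = let e , e∈O , lower = safe-choice p disjoint (∈-offers⁻ q p O∈) in ℕ.≤-trans
        (All.lookup (min≤xs n (map (λ e → value q k (claim p O e)) (elements O)))
          (∈-map⁺ (λ e → value q k (claim p O e)) (∈-elements⁺ e∈O)))
        (value-upper k (claim p O e) (claim-disjoint {p} disjoint e∈O) (ℕ.≤-trans lower ≤B))

  potential-start : ∀ E → n * suc E ≤ N * E →
                    potential (start n) ≤ n * (N ^ n′ * ((2 * E + 2) * (1 + (2 * E + 1) * K)) ^ K)
  potential-start E spread = begin
    potential (start n)                    ≤⟨ ∑-mono (allFin n) (λ {v} _ → at v) ⟩
    ∑ (allFin n) (λ _ → N ^ n′ * (H * (1 + A)) ^ K) ≡⟨ ∑-const (allFin n) _ ⟩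
    length (allFin n) * (N ^ n′ * (H * (1 + A)) ^ K) ≡⟨ cong (_* (N ^ n′ * (H * (1 + A)) ^ K)) (List.length-tabulate {n = n} (λ i → i)) ⟩
    n * (N ^ n′ * (H * (1 + A)) ^ K) ∎
    where
    open ℕ.≤-Reasoning hiding (start)
    open Upper {n} {N} E K spread
    light : ∀ c y → weight (start n) c y ≤ 1
    light c y with c Fin.≟ y
    ... | yes _  = z≤n
    ... | no c≢y with proj₁ (joining c≢y) ∈ˡ? [] | proj₁ (joining c≢y) ∈? ⊤
    ...   | no _ | yes _ = ℕ.≤-refl
    ...   | no _ | no _  = z≤n
    at : ∀ v → branch (weight (start n)) K n′ (v ∷ []) ≤ N ^ n′ * (H * (1 + A)) ^ K
    at v = ℕ.*-cancelˡ-≤ H {{ℕ.>-nonZero (ℕ.≤-trans (s≤s z≤n) (ℕ.m≤n+m 2 (2 * E)))}} (begin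
      H * branch (weight (start n)) K n′ (v ∷ [])        ≤⟨ branch-upper light K n′ (v ∷ []) ℕ.≤-refl ⟩
      N ^ n′ * (H ^ suc K * (1 + A) ^ K)                 ≡⟨ rearrange₁ H (N ^ n′) (H ^ K) ((1 + A) ^ K) ⟩
      H * (N ^ n′ * (H ^ K * (1 + A) ^ K))               ≡⟨ cong (λ z → H * (N ^ n′ * z)) (^-distribʳ-* K H (1 + A)) ⟨
      H * (N ^ n′ * (H * (1 + A)) ^ K) ∎)
      where
      rearrange₁ : ∀ H a b c → a * (H * b * c) ≡ H * (a * (b * c))
      rearrange₁ = solve-∀

-- The potentials give `s ^ K ≤ n * X ^ K`. Since `n ≤ 2 ^ K`, summing over all roots costs only a
-- factor 2 after the `K`-th root is taken.
client-bound : ∀ n q E K → n ≤ 2 ^ K → 1 ≤ K → n * suc E ≤ suc q * E →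
               𝓛 n q ≤ 2 * ((2 * E + 2) * (1 + (2 * E + 1) * K))
client-bound zero     q E K n≤ 1≤K spread = z≤n
client-bound (suc n′) q E K n≤ 1≤K spread = value-upper enough (length (edges (suc n′))) (start (suc n′)) (λ ())
    (potential-start E spread)
  where
  open ClientSide n′ q K
  open ℕ.≤-Reasoning hiding (start)
  X N : ℕ
  X = (2 * E + 2) * (1 + (2 * E + 1) * K)
  N = suc q
  enough : ∀ s → N ^ n′ * s ^ K ≤ suc n′ * (N ^ n′ * X ^ K) → s ≤ 2 * X
  enough s le = ℕ.≮⇒≥ λ 2X<s → ℕ.<⇒≱ (ℕ.^-monoˡ-< K {{ℕ.>-nonZero 1≤K}} 2X<s) (begin
    s ^ K          ≤⟨ ℕ.*-cancelˡ-≤ (N ^ n′) {{ℕ.m^n≢0 N n′}} (begin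
                        N ^ n′ * s ^ K            ≤⟨ le ⟩
                        suc n′ * (N ^ n′ * X ^ K) ≡⟨ x∙yz≈y∙xz ℕ.*-commutativeSemigroup (suc n′) (N ^ n′) (X ^ K) ⟩
                        N ^ n′ * (suc n′ * X ^ K) ∎) ⟩
    suc n′ * X ^ K ≤⟨ ℕ.*-monoˡ-≤ (X ^ K) n≤ ⟩
    2 ^ K * X ^ K  ≡⟨ ^-distribʳ-* K 2 X ⟨
    (2 * X) ^ K    ∎)

-- Waiter's degree sequences

-- The list records how many free edges each outside vertex sends to the tree that Client
-- has been forced to build. Waiter offers all recorded edges of the vertices in X: one of
-- these vertices joins the tree, and each other outside vertex gains the edge to it.
data Wins (N : ℕ) : ℕ → List ℕ → Set where
  done    : ∀ {ds} → Wins N 0 ds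
  permute : ∀ {t ds ds′} → ds ↭ ds′ → Wins N t ds′ → Wins N t ds
  shrink  : ∀ {t d d′ ds} → d′ ≤ d → Wins N t (d′ ∷ ds) → Wins N t (d ∷ ds)
  offer   : ∀ {t} X Y → ListAction.sum X ≡ N → Wins N t (replicate (length X ∸ 1) 1 ++ map suc Y) →
            Wins N (suc t) (X ++ Y)

range : ℕ → ℕ → List ℕ
range lo zero    = []
range lo (suc m) = lo ∷ range (suc lo) m

map-suc-range : ∀ lo m → map suc (range lo m) ≡ range (suc lo) m
map-suc-range lo zero    = refl
map-suc-range lo (suc m) = cong (suc lo ∷_) (map-suc-range (suc lo) m)

range-∷ʳ : ∀ lo m → range lo (suc m) ≡ range lo m ++ [ lo + m ]
range-∷ʳ lo zero    = cong [_] (sym (ℕ.+-identityʳ lo))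
range-∷ʳ lo (suc m) = cong (lo ∷_) (trans (range-∷ʳ (suc lo) m) (cong (λ z → range (suc lo) m ++ [ z ]) (sym (ℕ.+-suc lo m))))

sum-ones : ∀ a → ListAction.sum (replicate a 1) ≡ a
sum-ones zero    = refl
sum-ones (suc a) = cong suc (sum-ones a)

replicate-+ : ∀ {A : Set} a b (x : A) → replicate (a + b) x ≡ replicate a x ++ replicate b x
replicate-+ zero    b x = refl
replicate-+ (suc a) b x = cong (x ∷_) (replicate-+ a b x)

-- Whichever of the `a + 1` offered vertices joins, the other `a` are left with just the edge to the
-- new tree vertex. The ones thus reproduce themselves and only `d` is used up.
offer-ones : ∀ {N t} a d Y → a + d ≡ N → Wins N t (replicate a 1 ++ map suc Y) →
             Wins N (suc t) (replicate a 1 ++ d ∷ Y)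
offer-ones {N} {t} a d Y eq w = subst (Wins N (suc t)) (List.++-assoc (replicate a 1) [ d ] Y)
  (offer (replicate a 1 ++ [ d ]) Y
    (trans (ListAction.sum-++ (replicate a 1) [ d ]) (trans (cong₂ _+_ (sum-ones a) (ℕ.+-identityʳ d)) eq))
    (subst (λ l → Wins N t (replicate (l ∸ 1) 1 ++ map suc Y)) (sym len) w))
  where
  len : length (replicate a 1 ++ [ d ]) ≡ suc a
  len = trans (List.length-++ (replicate a 1)) (trans (ℕ.+-comm _ 1) (cong suc (List.length-replicate a)))

-- An offer of `N` edges at a single vertex forces Client to attach that vertex; `shrink` forgets
-- the surplus edges.
wins-forced : ∀ {N} z e → N ≤ e → Wins N z (replicate z e)
wins-forced zero    e _   = done
wins-forced {N} (suc z) e N≤e = shrink N≤e (offer-ones 0 N (replicate z e) refl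
  (subst (Wins N z) (sym (List.map-replicate suc z e)) (wins-forced z (suc e) (ℕ.m≤n⇒m≤1+n N≤e))))

-- Each round spends the largest entry of the range together with the ones. The remaining entries
-- rise by one, so the next largest entry has the same size and again completes an offer of `N`
-- edges.
wins-staircase : ∀ {N t} m lo a z e → a + (lo + m) ≡ suc N → Wins N t (replicate a 1 ++ replicate z (m + e)) →
                 Wins N (m + t) (replicate a 1 ++ range lo m ++ replicate z e)
wins-staircase zero    lo a z e eq w = w
wins-staircase {N} {t} (suc m) lo a z e eq w = permute
  (Perm.++⁺ˡ (replicate a 1) (↭-trans
    (↭-reflexive (trans (cong (_++ replicate z e) (range-∷ʳ lo m)) (List.++-assoc (range lo m) [ lo + m ] _)))
    (Perm.shift (lo + m) (range lo m) (replicate z e))))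
  (offer-ones a (lo + m) (range lo m ++ replicate z e) (ℕ.suc-injective (trans (sym shift) eq))
    (subst (λ l → Wins N (m + t) (replicate a 1 ++ l))
      (sym (trans (List.map-++ suc (range lo m) (replicate z e)) (cong₂ _++_ (map-suc-range lo m) (List.map-replicate suc z e))))
      (wins-staircase m (suc lo) a z (suc e) (trans (cong (a +_) (sym (ℕ.+-suc lo m))) eq)
        (subst (λ d → Wins N t (replicate a 1 ++ replicate z d)) (sym (ℕ.+-suc m e)) w))))
  where
  shift : a + (lo + suc m) ≡ suc (a + (lo + m))
  shift = trans (cong (a +_) (ℕ.+-suc lo m)) (ℕ.+-suc a (lo + m))

-- The tree has i + 2 vertices, and r outside vertices have not been offered yet.
wins-untouched : ∀ {N t} r i a z e → suc (a + r + i) ≡ N →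
  Wins N t (replicate a 1 ++ range 2 (r + i) ++ replicate z (r + e)) →
  Wins N (r + t) (replicate (a + r) 1 ++ range 2 i ++ replicate r (2 + i) ++ replicate z e)
wins-untouched {N} zero    i a z e eq w rewrite ℕ.+-identityʳ a = w
wins-untouched {N} {t} (suc r) i a z e eq w rewrite ℕ.+-suc a r = permute
  (↭-trans (↭-prep 1 (Perm.++⁺ˡ (replicate (a + r) 1)
      (Perm.shift (2 + i) (range 2 i) (replicate r (2 + i) ++ replicate z e))))
    (↭-sym (Perm.shift 1 (replicate (a + r) 1) (2 + i ∷ range 2 i ++ replicate r (2 + i) ++ replicate z e))))
  (permute (Perm.++⁺ˡ (replicate (a + r) 1) (↭-swap 1 (2 + i) ↭-refl))
  (offer-ones (a + r) (2 + i) (range 1 (suc i) ++ replicate r (2 + i) ++ replicate z e)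
    (trans (trans (ℕ.+-suc (a + r) (suc i)) (cong suc (ℕ.+-suc (a + r) i))) eq)
    (subst (λ l → Wins N (r + t) (replicate (a + r) 1 ++ l)) (sym shifted)
      (wins-untouched r (suc i) a z (suc e) (trans (cong suc (ℕ.+-suc (a + r) i)) eq)
        (subst₂ (λ l d → Wins N t (replicate a 1 ++ range 2 l ++ replicate z d)) (sym (ℕ.+-suc r i)) (sym (ℕ.+-suc r e)) w)))))
  where
  shifted : map suc (range 1 (suc i) ++ replicate r (2 + i) ++ replicate z e)
            ≡ range 2 (suc i) ++ replicate r (3 + i) ++ replicate z (suc e)
  shifted = trans (List.map-++ suc (range 1 (suc i)) _) (cong₂ _++_ (map-suc-range 1 (suc i))
    (trans (List.map-++ suc (replicate r (2 + i)) _) (cong₂ _++_ (List.map-replicate suc r (2 + i)) (List.map-replicate suc z e))))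

-- After the opening offer of `N` ones, `b` vertices of degree 2 are used up by `wins-untouched`,
-- whose skipped ones build the staircase for the last `b` rounds. The `z` spare vertices are never
-- offered and gain an edge in each of the `2b + 1` rounds.
wins-start : ∀ {t} a b z → Wins (suc (a + b)) t (replicate a 1 ++ replicate z (b + (b + 2))) →
             Wins (suc (a + b)) (suc (b + (b + t))) (replicate (suc (a + b) + (b + z)) 1)
wins-start {t} a b z w = subst (Wins N (suc (b + (b + t)))) (sym (replicate-+ N (b + z) 1))
  (offer (replicate N 1) (replicate (b + z) 1) (sum-ones N)
    (subst (λ l → Wins N (b + (b + t)) l) (sym after)
      (wins-untouched b 0 a z 2 (cong suc (ℕ.+-identityʳ (a + b)))
        (subst (λ m → Wins N (b + t) (replicate a 1 ++ range 2 m ++ replicate z (b + 2))) (sym (ℕ.+-identityʳ b))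
          (wins-staircase b 2 a z (b + 2) (trans (ℕ.+-suc a (suc b)) (cong suc (ℕ.+-suc a b))) w)))))
  where
  N : ℕ
  N = suc (a + b)
  after : replicate (length (replicate N 1) ∸ 1) 1 ++ map suc (replicate (b + z) 1)
          ≡ replicate (a + b) 1 ++ replicate b 2 ++ replicate z 2
  after = cong₂ (λ l ds → replicate (l ∸ 1) 1 ++ ds) (List.length-replicate N)
    (trans (List.map-replicate suc (b + z) 1) (replicate-+ b z 2))

wins-tight : ∀ a b → Wins (suc (a + b)) (suc (b + b)) (replicate (suc (a + b) + b) 1)
wins-tight a b = subst₂ (λ t l → Wins (suc (a + b)) (suc (b + t)) (replicate (suc (a + b) + l) 1))
  (ℕ.+-identityʳ b) (ℕ.+-identityʳ b) (wins-start a b 0 done)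

-- With `a = 0` and `b = q` nothing remains but the `z` spare vertices, each with `2q + 2 ≥ q + 1`
-- edges to the tree.
wins-spanning : ∀ q z → Wins (suc q) (suc q + (q + z)) (replicate (suc q + (q + z)) 1)
wins-spanning q z = wins-start 0 q z (wins-forced z (q + (q + 2))
  (ℕ.≤-trans (ℕ.≤-trans (ℕ.n≤1+n (suc q)) (ℕ.≤-reflexive (ℕ.+-comm 2 q))) (ℕ.m≤n+m (q + 2) q)))

-- Waiter's tree

component≤largestOrder : ∀ {n} (G : Graph n) v → ∣ component G v ∣ ≤ largestOrder G
component≤largestOrder {n} G v = All.lookup (xs≤max 0 (map (λ v → ∣ component G v ∣) (allFin n)))
  (∈-map⁺ (λ v → ∣ component G v ∣) (∈-allFin v))

largestOrder-∷ : ∀ {n} (G : Graph n) e → largestOrder G ≤ largestOrder (e ∷ G)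
largestOrder-∷ {n} G e = max≤v⁺ {xs = map (λ v → ∣ component G v ∣) (allFin n)} z≤n (All.map⁺ (All.tabulate λ {v} _ →
  ℕ.≤-trans (p⊆q⇒∣p∣≤∣q∣ {p = component G v} {q = component (e ∷ G) v} λ u∈ →
      ∈-subset⁺ (connected? (e ∷ G) v) (Eq.map there (∈-subset⁻ (connected? G v) u∈)))
    (component≤largestOrder (e ∷ G) v)))

module _ {n q : ℕ} where

  offer-lower : ∀ {v} k (p : Position n) {O} → IsOffer q p O → (∀ {e} → e ∈ O → v ≤ value q k (claim p O e)) →
                v ≤ value q (suc k) p
  offer-lower {v} k p {O} legal h with suc q ℕ.≤? ∣ free p ∣
  ... | no few = contradiction (subst (_≤ ∣ free p ∣) (proj₂ legal) (p⊆q⇒∣p∣≤∣q∣ (proj₁ legal))) few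
  ... | yes _  = ℕ.≤-trans
    (v≤min⁺ {xs = map (λ e → value q k (claim p O e)) (elements O)}
      -- The cap `n` in `offerValue` does no harm: `v` is at most the value of some claim, which is
      -- at most `n`.
      (let e , e∈O = nonempty O (proj₂ legal) in ℕ.≤-trans (h e∈O) (value≤n q k (claim p O e)))
      (All.map⁺ (All.tabulate (h ∘ ∈-elements⁻))))
    (All.lookup (xs≤max 0 (map (offerValue q k p) (offers q p))) (∈-map⁺ (offerValue q k p) (∈-offers⁺ q p legal)))

  -- Client's graph only grows, so once the tree is large enough Waiter may continue with arbitrary
  -- offers.
  largestOrder≤value : ∀ k (p : Position n) → largestOrder (clientGraph p) ≤ value q k p
  largestOrder≤value zero    p = ℕ.≤-refl
  largestOrder≤value (suc k) p = by (suc q ℕ.≤? ∣ free p ∣)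
    where
    finished : ¬ suc q ≤ ∣ free p ∣ → value q k (finish p) ≤ value q (suc k) p
    finished few with suc q ℕ.≤? ∣ free p ∣
    ... | yes enough = contradiction enough few
    ... | no  _      = ℕ.≤-refl
    by : Dec (suc q ≤ ∣ free p ∣) → largestOrder (clientGraph p) ≤ value q (suc k) p
    by (no few)     = ℕ.≤-trans (largestOrder≤value k (finish p)) (finished few)
    by (yes enough) = let O , legal = subset-of-size (suc q) (free p) enough in offer-lower k p legal λ {e} _ →
      ℕ.≤-trans (largestOrder-∷ (clientGraph p) (lookup (edges n) e)) (largestOrder≤value k (claim p O e))

module _ {n : ℕ} where

  open DecMembership (Fin._≟_ {length (edges n)}) using () renaming (_∈?_ to _∈ˡ?_)

  Spoke : Position n → List (Fin n) → Fin n → Edge n → Set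
  Spoke p C x e = e ∈ free p × ∃ λ c → c ∈ˡ C × Joins e x c

  -- The edges in `es` need not be all spokes of `x`. A recorded degree is thus a lower bound, which
  -- is what makes `shrink` sound.
  Attached : Position n → List (Fin n) → Fin n × ℕ → Set
  Attached p C (x , d) = ∃ λ es → length es ≡ d × Unique es × All (Spoke p C x) es

  names : List (Fin n × ℕ) → List (Fin n)
  names = map proj₁

  -- The tree spans C; a column (x , d) is an outside vertex x with d free edges to C.
  record Grown (p : Position n) (C : List (Fin n)) (cols : List (Fin n × ℕ)) : Set where
    field
      root      : Fin n
      connected : All (Connected (clientGraph p) root) C
      uniqueC   : Unique C
      unique    : Unique (names cols)
      offTree   : All (_∉ˡ C) (names cols)
      attached  : All (Attached p C) cols
      between   : ∀ {x y e} → x ∈ˡ names cols → y ∈ˡ names cols → Joins e x y → e ∈ free p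

  open Grown

  unique-resp-↭ : ∀ {A : Set} {xs ys : List A} → xs ↭ ys → Unique xs → Unique ys
  unique-resp-↭ p = PermSetoid.Unique-resp-↭ (setoid _) (↭⇒↭ₛ p)

  grown-resp-↭ : ∀ {p C cols cols′} → cols ↭ cols′ → Grown p C cols → Grown p C cols′
  grown-resp-↭ σ g = record
    { root      = root g
    ; connected = connected g
    ; uniqueC   = uniqueC g
    ; unique    = unique-resp-↭ (Perm.map⁺ proj₁ σ) (unique g)
    ; offTree   = Perm.All-resp-↭ (Perm.map⁺ proj₁ σ) (offTree g)
    ; attached  = Perm.All-resp-↭ σ (attached g)
    ; between   = λ x∈ y∈ → between g (Perm.∈-resp-↭ (↭-sym (Perm.map⁺ proj₁ σ)) x∈)
                                      (Perm.∈-resp-↭ (↭-sym (Perm.map⁺ proj₁ σ)) y∈)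
    }

  grown-shrink : ∀ {p C x d d′ cols} → d′ ≤ d → Grown p C ((x , d) ∷ cols) → Grown p C ((x , d′) ∷ cols)
  grown-shrink {d′ = d′} d′≤d g with attached g
  ... | (es , len , un , spokes) ∷ rest = record
    { root = root g ; connected = connected g ; uniqueC = uniqueC g ; unique = unique g ; offTree = offTree g
    ; attached = (take d′ es , trans (List.length-take d′ es) (ℕ.m≤n⇒m⊓n≡m (subst (d′ ≤_) (sym len) d′≤d))
                 , Unique.take⁺ d′ un , All.take⁺ d′ spokes) ∷ rest
    ; between = between g }

  spoke-outside : ∀ {p C x y z e} → y ∉ˡ C → z ∉ˡ C → Spoke p C x e → ¬ Joins e y z
  spoke-outside y∉ z∉ (_ , c , c∈ , j) j′ with joins-ends j j′
  ... | inj₁ (_ , refl) = z∉ c∈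
  ... | inj₂ (_ , refl) = y∉ c∈

  spoke-name : ∀ {p p′ C x y e} → x ∉ˡ C → Spoke p C x e → Spoke p′ C y e → x ≡ y
  spoke-name x∉ (_ , c , c∈ , j) (_ , d , d∈ , j′) with joins-ends j j′
  ... | inj₁ (x≡y , _)  = x≡y
  ... | inj₂ (refl , _) = contradiction d∈ x∉

  Stem : Position n → List (Fin n) → List (Fin n × ℕ) → Edge n → Set
  Stem p C cols e = ∃ λ x → x ∈ˡ names cols × Spoke p C x e

  -- Each spoke determines its end outside the tree, so different columns contribute different edges
  -- and the lengths add up exactly.
  gather : ∀ {p C} cols → Unique (names cols) → All (_∉ˡ C) (names cols) → All (Attached p C) cols →
           ∃ λ es → length es ≡ ListAction.sum (map proj₂ cols) × Unique es × All (Stem p C cols) es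
  gather [] _ _ _ = [] , refl , [] , []
  gather {p} {C} ((x , d) ∷ cols) (x≢ ∷ un) (x∉ ∷ outs) ((es , len , un-es , spokes) ∷ att) =
    let fs , len′ , un-fs , stems = gather {p} {C} cols un outs att in
      es ++ fs
    , trans (List.length-++ es) (cong₂ _+_ len len′)
    , Unique.++⁺ un-es un-fs (λ (e∈es , e∈fs) → let y , y∈ , s = All.lookup stems e∈fs in
        All.lookup x≢ y∈ (spoke-name {p} {p} x∉ (All.lookup spokes e∈es) s))
    , All.++⁺ (All.map (λ s → x , here refl , s) spokes) (All.map (λ (y , y∈ , s) → y , there y∈ , s) stems)

  module Round {q p C} (X Y : List (Fin n × ℕ)) (g : Grown p C (X ++ Y))
               (full : ListAction.sum (map proj₂ X) ≡ suc q) where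

    private
      split-unique : Unique (names X ++ names Y)
      split-unique = subst Unique (List.map-++ proj₁ X Y) (unique g)
      split-outside : All (_∉ˡ C) (names X ++ names Y)
      split-outside = subst (All (_∉ˡ C)) (List.map-++ proj₁ X Y) (offTree g)

      gathered = gather {p} {C} X (unique-++ˡ (names X) split-unique) (All.++⁻ˡ (names X) split-outside) (All.++⁻ˡ X (attached g))
        where
        unique-++ˡ : ∀ {A : Set} (xs : List A) {ys} → Unique (xs ++ ys) → Unique xs
        unique-++ˡ []       _          = []
        unique-++ˡ (x ∷ xs) (x≢ ∷ un) = All.++⁻ˡ xs x≢ ∷ unique-++ˡ xs un

      es = proj₁ gathered

      stem : ∀ {e} → e ∈ˡ es → Stem p C X e
      stem = All.lookup (proj₂ (proj₂ (proj₂ gathered)))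

    offered : EdgeSet n
    offered = subset (_∈ˡ? es)

    private
      stem′ : ∀ {e} → e ∈ offered → Stem p C X e
      stem′ e∈ = stem (∈-subset⁻ (_∈ˡ? es) e∈)

    legal : IsOffer q p offered
    legal = (λ e∈ → proj₁ (proj₂ (proj₂ (stem′ e∈)))) ,
      trans (ℕ.≤-antisym (∣p∣≤length offered es (∈-subset⁻ (_∈ˡ? es)))
                         (unique⇒length≤∣p∣ (proj₁ (proj₂ (proj₂ gathered))) (All.tabulate (∈-subset⁺ (_∈ˡ? es)))))
            (trans (proj₁ (proj₂ gathered)) full)

    module _ {x e c} (e∈O : e ∈ offered) (c∈ : c ∈ˡ C) (joins : Joins e x c)
             {d} (R : List (Fin n × ℕ)) (X↭ : X ↭ (x , d) ∷ R) where

      private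
        p′ = claim p offered e

        new : List (Fin n × ℕ)
        new = map (λ (y , _) → y , 1) R ++ map (map₂ suc) Y

        new-names : names new ≡ names R ++ names Y
        new-names = trans (List.map-++ proj₁ (map (λ (y , _) → y , 1) R) (map (map₂ suc) Y))
          (cong₂ _++_ (sym (List.map-∘ R)) (sym (List.map-∘ Y)))

        ↭names : names X ++ names Y ↭ x ∷ names R ++ names Y
        ↭names = Perm.++⁺ʳ (names Y) (Perm.map⁺ proj₁ X↭)

        all-unique : Unique (x ∷ names R ++ names Y)
        all-unique = unique-resp-↭ ↭names split-unique
        all-outside : All (_∉ˡ C) (x ∷ names R ++ names Y)
        all-outside = Perm.All-resp-↭ ↭names split-outside

        x≢ : All (x ≢_) (names R ++ names Y)
        x≢ with all-unique
        ... | x≢ ∷ _ = x≢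

        ∉C : ∀ {y} → y ∈ˡ names R ++ names Y → y ∉ˡ C
        ∉C y∈ = All.lookup all-outside (there y∈)

        x∉C : x ∉ˡ C
        x∉C = All.lookup all-outside (here refl)

        -- Every offered edge has an end in `C`, so edges among the columns stay free. Those at `x`
        -- become spokes to the new tree vertex.
        inside-free : ∀ {y z f} → y ∈ˡ x ∷ names R ++ names Y → z ∈ˡ x ∷ names R ++ names Y → Joins f y z → f ∈ free p′
        inside-free y∈ z∈ j = x∈p∧x∉q⇒x∈p─q
          (between g (back y∈) (back z∈) j)
          (λ f∈O → spoke-outside {p} (All.lookup all-outside y∈) (All.lookup all-outside z∈) (proj₂ (proj₂ (stem′ f∈O))) j)
          where
          back : ∀ {y} → y ∈ˡ x ∷ names R ++ names Y → y ∈ˡ names (X ++ Y)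
          back y∈ = subst (_ ∈ˡ_) (sym (List.map-++ proj₁ X Y)) (Perm.∈-resp-↭ (↭-sym ↭names) y∈)

        spoke-x : ∀ {y} → y ∈ˡ names R ++ names Y → ∃ λ f → Joins f y x × Spoke p′ (x ∷ C) y f
        spoke-x y∈ = let f , j = joining (λ eq → All.lookup x≢ y∈ (sym eq))
                     in f , j , inside-free (there y∈) (here refl) j , x , here refl , j

        attached-R : ∀ {y d} → (y , d) ∈ˡ R → Attached p′ (x ∷ C) (y , 1)
        attached-R y∈ = let f , _ , s = spoke-x (∈-++⁺ˡ (∈-map⁺ proj₁ y∈)) in [ f ] , refl , [] ∷ [] , s ∷ []

        attached-Y : ∀ {y d} → (y , d) ∈ˡ Y → Attached p′ (x ∷ C) (y , suc d)
        attached-Y {y} y∈ = let fs , len , un , spokes = All.lookup (All.++⁻ʳ X (attached g)) y∈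
                                f , j , s = spoke-x y∈names
          in f ∷ fs , cong suc len
           , All.map (λ { s′ refl → spoke-outside {p} (∉C y∈names) x∉C s′ j }) spokes ∷ un
           , s ∷ All.map old spokes
          where
          y∈names : y ∈ˡ names R ++ names Y
          y∈names = ∈-++⁺ʳ (names R) (∈-map⁺ proj₁ y∈)
          unoffered : ∀ {f} → Spoke p C y f → f ∉ offered
          unoffered s f∈O = let z , z∈ , s′ = stem′ f∈O in
            separate split-unique z∈ (∈-map⁺ proj₁ y∈) (sym (spoke-name {p} {p} (∉C y∈names) s s′))
            where
            separate : {A : Set} {xs ys : List A} → Unique (xs ++ ys) → ∀ {u v} → u ∈ˡ xs → v ∈ˡ ys → u ≢ v
            separate {xs = _ ∷ xs} (u≢ ∷ _) (here refl) v∈ = All.lookup u≢ (∈-++⁺ʳ xs v∈)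
            separate (_ ∷ un) (there u∈) v∈ = separate un u∈ v∈
          old : ∀ {f} → Spoke p C y f → Spoke p′ (x ∷ C) y f
          old s@(f∈ , c , c∈ , j) = x∈p∧x∉q⇒x∈p─q f∈ (unoffered s) , c , there c∈ , j

        edge : ∀ {a b} → Joins e a b → SymClosure (Adjacent (clientGraph p′)) b a
        edge (inj₁ eq) = bwd (here (sym eq))
        edge (inj₂ eq) = fwd (here (sym eq))

      grown : Grown p′ (x ∷ C) new
      grown = record
        { root      = root g
        ; connected = (Eq.map there (All.lookup (connected g) c∈) ◅◅ (edge joins ◅ stay)) ∷ All.map (Eq.map there) (connected g)
        ; uniqueC   = All.tabulate (λ { y∈ refl → x∉C y∈ }) ∷ uniqueC g
        ; unique    = subst Unique (sym new-names) (tail all-unique)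
        ; offTree   = subst (All (_∉ˡ (x ∷ C))) (sym new-names) (All.tabulate λ y∈ → λ
                        { (here eq) → All.lookup x≢ y∈ (sym eq) ; (there y∈C) → ∉C y∈ y∈C })
        ; attached  = All.++⁺ (All.map⁺ (All.tabulate attached-R)) (All.map⁺ (All.tabulate attached-Y))
        ; between   = λ y∈ z∈ → inside-free (there (subst (_ ∈ˡ_) new-names y∈)) (there (subst (_ ∈ˡ_) new-names z∈))
        }
        where
        tail : ∀ {A : Set} {y} {ys : List A} → Unique (y ∷ ys) → Unique ys
        tail (_ ∷ un) = un

      new-degrees : map proj₂ new ≡ replicate (length X ∸ 1) 1 ++ map suc (map proj₂ Y)
      new-degrees = trans (List.map-++ proj₂ (map (λ (y , _) → y , 1) R) (map (map₂ suc) Y))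
        (cong₂ _++_ (trans (ones R) (cong (λ l → replicate (l ∸ 1) 1) (sym (Perm.↭-length X↭))))
                    (trans (sym (List.map-∘ Y)) (List.map-∘ Y)))
        where
        ones : ∀ (R : List (Fin n × ℕ)) → map proj₂ (map (λ (y , _) → y , 1) R) ≡ replicate (length R) 1
        ones []      = refl
        ones (_ ∷ R) = cong (1 ∷_) (ones R)

    -- Client's edge decides only which column of `X` joins the tree. The resulting degrees depend
    -- on `length X` and `Y` alone, so a single derivation of `Wins` serves against all answers.
    reply : ∀ {e} → e ∈ offered → ∃₂ λ x cols → Grown (claim p offered e) (x ∷ C) cols
            × map proj₂ cols ≡ replicate (length X ∸ 1) 1 ++ map suc (map proj₂ Y)
    reply e∈O =
      let x , x∈ , _ , c , c∈ , j = stem′ e∈O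
          (_ , d) , xd∈ , eq = ∈-map⁻ proj₁ x∈
          As , Bs , X≡ = ∈-∃++ xd∈
          X↭ = ↭-trans (↭-reflexive X≡) (Perm.shift _ As Bs)
          j′ = subst (λ x → Joins _ x c) eq j
      in _ , _ , grown e∈O c∈ j′ (As ++ Bs) X↭ , new-degrees e∈O c∈ j′ (As ++ Bs) X↭

-- From degree sequences to the value of the game.

map-split : ∀ {A B : Set} (f : A → B) xs ys {zs} → map f xs ≡ ys ++ zs →
            ∃₂ λ as bs → xs ≡ as ++ bs × map f as ≡ ys × map f bs ≡ zs
map-split f xs       []       eq = [] , xs , refl , refl , eq
map-split f (x ∷ xs) (y ∷ ys) eq =
  let as , bs , eq₁ , eq₂ , eq₃ = map-split f xs ys (List.∷-injectiveʳ eq)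
  in x ∷ as , bs , cong (x ∷_) eq₁ , cong₂ _∷_ (List.∷-injectiveˡ eq) eq₂ , eq₃

-- The derivation of `Wins` serves as Waiter's strategy: an `offer` is one round and adds one vertex
-- to `C`, whereas `permute` and `shrink` only change the record.
wins⇒value : ∀ {n q t ds} → Wins (suc q) t ds → ∀ k (p : Position n) {C cols} → map proj₂ cols ≡ ds →
             Grown p C cols → ∣ free p ∣ ≤ k → length C + t ≤ value q k p
wins⇒value {q = q} done k p {C} _ g _ = begin
  length C + 0                             ≡⟨ ℕ.+-identityʳ (length C) ⟩
  length C                                 ≤⟨ unique⇒length≤∣p∣ (uniqueC g) (All.map (∈-subset⁺ (connected? _ (root g))) (connected g)) ⟩
  ∣ component (clientGraph p) (root g) ∣   ≤⟨ component≤largestOrder (clientGraph p) (root g) ⟩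
  largestOrder (clientGraph p)             ≤⟨ largestOrder≤value k p ⟩
  value q k p                              ∎
  where
  open ℕ.≤-Reasoning hiding (start)
  open Grown
wins⇒value (permute ds↭ w) k p {cols = cols} eq g le =
  let cols′ , eq′ , cols↭ = Perm.↭-map-inv proj₂ (↭-trans (↭-reflexive eq) ds↭)
  in wins⇒value w k p (sym eq′) (grown-resp-↭ cols↭ g) le
wins⇒value (shrink d′≤d w) k p {cols = _ ∷ _} refl g le = wins⇒value w k p refl (grown-shrink d′≤d g) le
wins⇒value {q = q} {suc t} (offer X Y full w) k p {C} {cols} eq g le with map-split proj₂ cols X eq
... | Xc , Yc , refl , refl , refl = at k le
  where
  open Round Xc Yc g full
  some : 1 ≤ ∣ free p ∣
  some = ℕ.≤-trans (s≤s z≤n) (ℕ.≤-trans (ℕ.≤-reflexive (sym (proj₂ legal))) (p⊆q⇒∣p∣≤∣q∣ (proj₁ legal)))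
  at : ∀ k → ∣ free p ∣ ≤ k → length C + suc t ≤ value q k p
  at zero    le = contradiction (ℕ.≤-trans some le) λ ()
  at (suc k) le = offer-lower k p legal λ {e} e∈O →
    let x , cols′ , g′ , degrees = reply e∈O in
    ℕ.≤-trans (ℕ.≤-reflexive (ℕ.+-suc (length C) t))
      (wins⇒value w k (claim p offered e) (trans degrees
          (cong (λ l → replicate (l ∸ 1) 1 ++ map suc (map proj₂ Yc)) (sym (List.length-map proj₂ Xc)))) g′
        (ℕ.≤-pred (ℕ.≤-trans (claim-shrinks p legal) le)))

grown-start : ∀ n → Grown (start (suc n)) (zero ∷ []) (map (λ i → suc i , 1) (allFin n))
grown-start n = record
  { root      = zero
  ; connected = stay ∷ []
  ; uniqueC   = [] ∷ []
  ; unique    = subst Unique (List.map-∘ (allFin n)) (Unique.map⁺ Fin.suc-injective (Unique.allFin⁺ n))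
  ; offTree   = All.map⁺ (All.map⁺ (All.tabulate λ _ → λ { (here ()) ; (there ()) }))
  ; attached  = All.map⁺ (All.tabulate λ {i} _ → let e , j = joining {suc n} {suc i} {zero} (λ ()) in
                  [ e ] , refl , [] ∷ [] , (∈⊤ , zero , here refl , j) ∷ [])
  ; between   = λ _ _ _ → ∈⊤
  }

wins⇒𝓛 : ∀ {n q t} → Wins (suc q) t (replicate n 1) → suc t ≤ 𝓛 (suc n) q
wins⇒𝓛 {n} w = wins⇒value w _ (start (suc n)) (degrees n) (grown-start n)
  (ℕ.≤-reflexive (∣⊤∣≡n (length (edges (suc n)))))
  where
  ones : ∀ {A : Set} (xs : List A) {f : A → Fin (suc n)} → map proj₂ (map (λ i → f i , 1) xs) ≡ replicate (length xs) 1
  ones []       = refl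
  ones (_ ∷ xs) = cong (1 ∷_) (ones xs)
  degrees : ∀ m → map proj₂ (map (λ i → suc i , 1) (allFin n)) ≡ replicate n 1
  degrees _ = trans (ones (allFin n)) (cong (λ l → replicate l 1) (List.length-tabulate {n = n} (λ i → i)))

waiter-spanning : ∀ n q → 2 * suc q ≤ n → n ≤ 𝓛 n q
waiter-spanning n q le = subst (λ n → n ≤ 𝓛 n q) eq (wins⇒𝓛 (wins-spanning q (n ∸ 2 * suc q)))
  where
  eq : suc (suc q + (q + (n ∸ 2 * suc q))) ≡ n
  eq = trans (shape q (n ∸ 2 * suc q)) (ℕ.m+[n∸m]≡n le)
    where
    shape : ∀ q z → suc (suc q + (q + z)) ≡ 2 * suc q + z
    shape = solve-∀

waiter-bound : ∀ q b → b ≤ q → 2 * suc b ≤ 𝓛 (q + b + 2) q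
waiter-bound q b b≤q = subst₂ (λ l n → l ≤ 𝓛 n q) (rearrange₁ b) rearrange₂
  (wins⇒𝓛 (subst (λ z → Wins (suc z) (suc (b + b)) (replicate (suc z + b) 1)) (ℕ.m∸n+n≡m b≤q) (wins-tight (q ∸ b) b)))
  where
  rearrange₁ : ∀ b → suc (suc (b + b)) ≡ 2 * suc b
  rearrange₁ = solve-∀
  rearrange₂ : suc (suc q + b) ≡ q + b + 2
  rearrange₂ = ℕ.+-comm 2 (q + b)

-- Real estimates

fromℕℚ-mono : ∀ {a b} → a ≤ b → fromℕℚ a ≤ℚ fromℕℚ b
fromℕℚ-mono {a} {b} a≤b = subst₂ _≤ℚ_ (ℚ.+-identityʳ (fromℕℚ a))
  (trans (sym (fromℕℚ-+ a (b ∸ a))) (cong fromℕℚ (ℕ.m+[n∸m]≡n a≤b)))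
  (ℚ.+-monoʳ-≤ (fromℕℚ a) (0≤fromℕℚ (b ∸ a)))

fromℕℚ-cancel : ∀ {a b} → fromℕℚ a ≤ℚ fromℕℚ b → a ≤ b
fromℕℚ-cancel {a} {b} le = ℕ.≮⇒≥ λ b<a → ℚ.<-irrefl refl (ℚ.<-≤-trans below (ℚ.≤-trans (fromℕℚ-mono b<a) le))
  where
  below : fromℕℚ b <ℚ fromℕℚ (suc b)
  below = subst₂ _<ℚ_ (ℚ.+-identityˡ (fromℕℚ b)) (sym (fromℕℚ-+ 1 b)) (ℚ.+-monoˡ-< (fromℕℚ b) (ℚ.positive⁻¹ 1ℚ))

0≤recip : ∀ {p} → 0ℚ <ℚ p → 0ℚ ≤ℚ recip p
0≤recip 0<p = ℚ.<⇒≤ (recip-pos 0<p)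

0≤* : ∀ {p q} → 0ℚ ≤ℚ p → 0ℚ ≤ℚ q → 0ℚ ≤ℚ p *ℚ q
0≤* {p} {q} 0≤p 0≤q = subst (_≤ℚ p *ℚ q) (ℚ.*-zeroˡ q) (ℚ.*-monoʳ-≤-nonNeg q {{ℚ.nonNegative 0≤q}} 0≤p)

0≤harmonic : ∀ a l → 0ℚ ≤ℚ harmonic a l
0≤harmonic a zero    = ℚ.≤-refl
0≤harmonic a (suc l) = ℚ.+-mono-≤ (0≤harmonic a l) (0≤1/ℕ (a + l))

harmonic-mono : ∀ a {l m} → l ≤ m → harmonic a l ≤ℚ harmonic a m
harmonic-mono a {l} {m} l≤m = subst₂ _≤ℚ_ (ℚ.+-identityʳ (harmonic a l))
  (trans (sym (harmonic-+ a l (m ∸ l))) (cong (harmonic a) (ℕ.m+[n∸m]≡n l≤m)))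
  (ℚ.+-monoʳ-≤ (harmonic a l) (0≤harmonic (a + l) (m ∸ l)))

-- Each dyadic block from M 2^j to M 2^(j+1) contributes at least 1/2.
harmonic-dyadic : ∀ k j → ∃ λ l → suc k + l ≡ 2 ^ j * suc k × fromℕℚ j *ℚ ½ ≤ℚ harmonic (suc k) l
harmonic-dyadic k zero    = 0 , refl , ℚ.≤-refl
harmonic-dyadic k (suc j) with harmonic-dyadic k j
... | l , eq , le = l + (suc k + l)
  , trans (rearrange₁ k l) (trans (cong (2 *_) eq) (sym (ℕ.*-assoc 2 (2 ^ j) (suc k))))
  , subst₂ _≤ℚ_ (sym (fromℕℚ-suc-* j ½)) (sym (harmonic-+ (suc k) l (suc k + l)))
      (ℚ.+-mono-≤ le (subst (λ z → ½ ≤ℚ harmonic z (suc k + l)) (ℕ.+-identityʳ (suc k + l)) (block′ 0 (k + l))))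
  where
  rearrange₁ : ∀ k l → suc k + (l + (suc k + l)) ≡ 2 * (suc k + l)
  rearrange₁ = solve-∀

-- With mesh `1/(k+1)` the Riemann sum starts at `k + 1` and stops short of `n (k + 1)`, so it
-- contains the first `j` dyadic blocks.
ln-lower : ∀ n j k → 2 ^ j ≤ n → fromℕℚ j *ℚ ½ ≤ℚ seq (ln n) k
ln-lower n j k 2^j≤n with harmonic-dyadic k j
... | l , eq , le = ℚ.≤-trans le (harmonic-mono (suc k) (ℕ.+-cancelˡ-≤ (suc k) _ _ (begin
  suc k + l                  ≡⟨ eq ⟩
  2 ^ j * suc k              ≤⟨ ℕ.*-monoˡ-≤ (suc k) 2^j≤n ⟩
  n * suc k                  ≤⟨ ℕ.*-monoˡ-≤ (suc k) (ℕ.m≤n+m∸n n 1) ⟩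
  suc k + (n ∸ 1) * suc k    ∎)))
  where open ℕ.≤-Reasoning hiding (start)

log₂ : ∀ n → ∃ λ j → 2 ^ j ≤ suc n × suc n < 2 ^ suc j
log₂ zero    = 0 , s≤s z≤n , s≤s (s≤s z≤n)
log₂ (suc n) with log₂ n
... | j , lo , hi with suc (suc n) ℕ.<? 2 ^ suc j
...   | yes lt = j , ℕ.m≤n⇒m≤1+n lo , lt
...   | no  ge = suc j , ℕ.≮⇒≥ ge , ℕ.≤-<-trans hi (ℕ.^-monoʳ-< 2 (s≤s (s≤s z≤n)) (ℕ.n<1+n (suc j)))

-- `K` is the integer part of the binary logarithm plus one. As `n ≥ 2`, that integer part is at
-- least 1, so adding one at most doubles it. The other factor 2 comes from the 1/2 per dyadic
-- block.
ln-log₂ : ∀ n → 2 ≤ n → ∃ λ K → n ≤ 2 ^ K × 1 ≤ K × ∀ k → fromℕℚ K ≤ℚ fromℕℚ 4 *ℚ seq (ln n) k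
ln-log₂ (suc n) 2≤n with log₂ n
... | zero  , lo , hi = contradiction 2≤n (ℕ.<⇒≱ hi)
... | suc j , lo , hi = suc (suc j) , ℕ.<⇒≤ hi , s≤s z≤n , λ k → begin
  fromℕℚ (2 + j)                   ≤⟨ fromℕℚ-mono (s≤s (s≤s (ℕ.m≤m*n j 2))) ⟩
  fromℕℚ (suc j * 2)               ≡⟨ fromℕℚ-* (suc j) 2 ⟩
  fromℕℚ (suc j) *ℚ fromℕℚ 2       ≡⟨ solve 1 (λ x → x :* con (fromℕℚ 2) := con (fromℕℚ 4) :* (x :* con ½)) refl (fromℕℚ (suc j)) ⟩
  fromℕℚ 4 *ℚ (fromℕℚ (suc j) *ℚ ½) ≤⟨ ℚ.*-monoˡ-≤-nonNeg (fromℕℚ 4) (ln-lower (suc n) (suc j) k lo) ⟩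
  fromℕℚ 4 *ℚ seq (ln (suc n)) k ∎
  where open ℚ.≤-Reasoning

-- A search downwards from `N` replaces rounding `1/x` to an integer.
least-reciprocal : ∀ {x} N → 1/ℕ (suc N) ≤ℚ x → ∃ λ E → 1/ℕ (suc E) ≤ℚ x × (E ≡ 0 ⊎ x ≤ℚ 1/ℕ E)
least-reciprocal zero le = 0 , le , inj₁ refl
least-reciprocal {x} (suc N) le with 1/ℕ (suc N) ℚ.≤? x
... | yes le′ = least-reciprocal N le′
... | no  ≰   = suc N , le , inj₂ (ℚ.<⇒≤ (ℚ.≰⇒> ≰))

-- One unit fraction stands in for `ε` at all late indices. Late entries differ by at most half of a
-- positive lower bound, so with `x` half of one of them all lie between `x` and `3x`. If `x ≤ 1/E`,
-- then `(E + 1) e ≤ 2E * 3/E = 6`; if `E = 0`, then `e ≤ 1` suffices.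
unit-fraction : ∀ ε → fromℕ 0 <ᵣ ε → ε <ᵣ fromℕ 1 →
                ∃₂ λ E i₀ → ∀ i → i₀ ≤ i → 1/ℕ (suc E) ≤ℚ seq ε i × fromℕℚ (suc E) *ℚ seq ε i ≤ℚ fromℕℚ 6
unit-fraction ε (η , 0<η , N₁ , above) (θ , 0<θ , N₂ , below) with cauchy ε (η *ℚ ½) (half-pos 0<η)
... | N₃ , close = E , i₀ , λ i i₀≤i → ℚ.≤-trans E≤ (lower i i₀≤i) , upper i i₀≤i
  where
  i₀ : ℕ
  i₀ = N₁ ℕ.⊔ (N₂ ℕ.⊔ N₃)
  r x : ℚ
  r = seq ε i₀
  x = r *ℚ ½
  N₁≤ : ∀ {i} → i₀ ≤ i → N₁ ≤ i
  N₁≤ = ℕ.m⊔n≤o⇒m≤o N₁ _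
  N₂≤ : ∀ {i} → i₀ ≤ i → N₂ ≤ i
  N₂≤ le = ℕ.m⊔n≤o⇒m≤o N₂ N₃ (ℕ.m⊔n≤o⇒n≤o N₁ _ le)
  N₃≤ : ∀ {i} → i₀ ≤ i → N₃ ≤ i
  N₃≤ le = ℕ.m⊔n≤o⇒n≤o N₂ N₃ (ℕ.m⊔n≤o⇒n≤o N₁ _ le)
  η≤r : η ≤ℚ r
  η≤r = subst (_≤ℚ r) (ℚ.+-identityˡ η) (above i₀ (N₁≤ ℕ.≤-refl))
  η½≤x : η *ℚ ½ ≤ℚ x
  η½≤x = ℚ.*-monoʳ-≤-nonNeg ½ η≤r
  lower : ∀ i → i₀ ≤ i → x ≤ℚ seq ε i
  lower i le = subst₂ _≤ℚ_
    (solve 1 (λ r → r :- r :* con ½ := r :* con ½) refl r)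
    (solve 2 (λ e x → (e :+ x) :- x := e) refl (seq ε i) x)
    (ℚ.+-monoˡ-≤ (ℚ.- x) (ℚ.≤-trans
      (∣-∣≤⇒≤+ r (seq ε i) (close i₀ i (N₃≤ ℕ.≤-refl) (N₃≤ le)))
      (ℚ.+-monoʳ-≤ (seq ε i) η½≤x)))
  ≤3x : ∀ i → i₀ ≤ i → seq ε i ≤ℚ fromℕℚ 3 *ℚ x
  ≤3x i le = subst (seq ε i ≤ℚ_)
    (solve 1 (λ r → r :+ r :* con ½ := con (fromℕℚ 3) :* (r :* con ½)) refl r)
    (ℚ.≤-trans (∣-∣≤⇒≤+ (seq ε i) r (close i i₀ (N₃≤ le) (N₃≤ ℕ.≤-refl))) (ℚ.+-monoʳ-≤ r η½≤x))
  ≤1 : ∀ i → i₀ ≤ i → seq ε i ≤ℚ 1ℚ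
  ≤1 i le = ℚ.≤-trans (subst (_≤ℚ seq ε i +ℚ θ) (ℚ.+-identityʳ (seq ε i)) (ℚ.+-monoʳ-≤ (seq ε i) (ℚ.<⇒≤ 0<θ))) (below i (N₂≤ le))
  0<x : 0ℚ <ℚ x
  0<x = ℚ.<-≤-trans (half-pos 0<η) η½≤x
  least = least-reciprocal (proj₁ (archimedean x 0<x)) (proj₂ (archimedean x 0<x))
  E : ℕ
  E = proj₁ least
  E≤ : 1/ℕ (suc E) ≤ℚ x
  E≤ = proj₁ (proj₂ least)
  bound : ∀ E → E ≡ 0 ⊎ x ≤ℚ 1/ℕ E → ∀ i → i₀ ≤ i → fromℕℚ (suc E) *ℚ seq ε i ≤ℚ fromℕℚ 6
  bound zero    _         i le = subst (_≤ℚ fromℕℚ 6) (sym (ℚ.*-identityˡ (seq ε i))) (ℚ.≤-trans (≤1 i le) (fromℕℚ-mono {1} {6} (s≤s z≤n)))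
  bound (suc E) (inj₁ ()) i le
  bound (suc E) (inj₂ x≤) i le = begin
    fromℕℚ (2 + E) *ℚ seq ε i
      ≤⟨ *-mono (0≤fromℕℚ (2 + E)) (0≤* (0≤fromℕℚ 3) (0≤1/ℕ (suc E)))
           (fromℕℚ-mono {2 + E} {2 * suc E} (subst (2 + E ≤_) (ℕ.*-comm (suc E) 2) (s≤s (s≤s (ℕ.m≤m*n E 2)))))
           (ℚ.≤-trans (≤3x i le) (ℚ.*-monoˡ-≤-nonNeg (fromℕℚ 3) x≤)) ⟩
    fromℕℚ (2 * suc E) *ℚ (fromℕℚ 3 *ℚ 1/ℕ (suc E))
      ≡⟨ cong (_*ℚ (fromℕℚ 3 *ℚ 1/ℕ (suc E))) (fromℕℚ-* 2 (suc E)) ⟩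
    fromℕℚ 2 *ℚ fromℕℚ (suc E) *ℚ (fromℕℚ 3 *ℚ 1/ℕ (suc E))
      ≡⟨ solve 2 (λ a b → con (fromℕℚ 2) :* a :* (con (fromℕℚ 3) :* b) := con (fromℕℚ 6) :* (a :* b)) refl (fromℕℚ (suc E)) (1/ℕ (suc E)) ⟩
    fromℕℚ 6 *ℚ (fromℕℚ (suc E) *ℚ 1/ℕ (suc E))
      ≡⟨ cong (fromℕℚ 6 *ℚ_) (1/ℕ-inverse E) ⟩
    fromℕℚ 6 *ℚ 1ℚ ≡⟨⟩
    fromℕℚ 6 ∎
    where open ℚ.≤-Reasoning
  upper = bound E (proj₂ (proj₂ least))

spread : ∀ n q E e → 1/ℕ (suc E) ≤ℚ e → (1ℚ +ℚ e) *ℚ fromℕℚ n ≤ℚ fromℕℚ q +ℚ 1ℚ → n * suc (suc E) ≤ suc q * suc E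
spread n q E e 1/E≤e le = fromℕℚ-cancel (begin
  fromℕℚ (n * suc (suc E))                  ≡⟨ trans (fromℕℚ-* n (suc (suc E))) (cong (fromℕℚ n *ℚ_) (fromℕℚ-+ 1 (suc E))) ⟩
  fromℕℚ n *ℚ (1ℚ +ℚ F)                     ≡⟨ cong (λ z → fromℕℚ n *ℚ (z +ℚ F)) (1/ℕ-inverse E) ⟨
  fromℕℚ n *ℚ (F *ℚ 1/ℕ (suc E) +ℚ F)       ≡⟨ solve 3 (λ n f g → n :* (f :* g :+ f) := f :* ((con 1ℚ :+ g) :* n)) refl (fromℕℚ n) F (1/ℕ (suc E)) ⟩
  F *ℚ ((1ℚ +ℚ 1/ℕ (suc E)) *ℚ fromℕℚ n)    ≤⟨ ℚ.*-monoˡ-≤-nonNeg F {{ℚ.nonNegative (0≤fromℕℚ (suc E))}}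
                                               (ℚ.*-monoʳ-≤-nonNeg (fromℕℚ n) {{ℚ.nonNegative (0≤fromℕℚ n)}} (ℚ.+-monoʳ-≤ 1ℚ 1/E≤e)) ⟩
  F *ℚ ((1ℚ +ℚ e) *ℚ fromℕℚ n)              ≤⟨ ℚ.*-monoˡ-≤-nonNeg F {{ℚ.nonNegative (0≤fromℕℚ (suc E))}} le ⟩
  F *ℚ (fromℕℚ q +ℚ 1ℚ)                     ≡⟨ solve 2 (λ f q → f :* (q :+ con 1ℚ) := (con 1ℚ :+ q) :* f) refl F (fromℕℚ q) ⟩
  (1ℚ +ℚ fromℕℚ q) *ℚ F                     ≡⟨ cong (_*ℚ F) (fromℕℚ-+ 1 q) ⟨
  fromℕℚ (suc q) *ℚ F                       ≡⟨ fromℕℚ-* (suc q) (suc E) ⟨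
  fromℕℚ (suc q * suc E) ∎)
  where
  open ℚ.≤-Reasoning
  F : ℚ
  F = fromℕℚ (suc E)

coarse-bound : ∀ E K → 1 ≤ K → 2 * ((2 * suc E + 2) * (1 + (2 * suc E + 1) * K)) ≤ 32 * (suc E * suc E * K)
coarse-bound E K 1≤K = begin
  2 * ((2 * suc E + 2) * (1 + (2 * suc E + 1) * K))
    ≤⟨ ℕ.*-monoʳ-≤ 2 (ℕ.*-mono-≤ (ℕ.≤-trans (ℕ.m≤m+n (2 * suc E + 2) (2 * E)) (ℕ.≤-reflexive (rearrange₁ E)))
         (ℕ.≤-trans (ℕ.+-monoˡ-≤ ((2 * suc E + 1) * K) 1≤K)
           (ℕ.≤-trans (ℕ.m≤m+n (K + (2 * suc E + 1) * K) (2 * (E * K))) (ℕ.≤-reflexive (rearrange₂ E K))))) ⟩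
  2 * (4 * suc E * (4 * suc E * K)) ≡⟨ rearrange₃ E K ⟩
  32 * (suc E * suc E * K) ∎
  where
  open ℕ.≤-Reasoning hiding (start)
  rearrange₁ : ∀ E → 2 * suc E + 2 + 2 * E ≡ 4 * suc E
  rearrange₁ = solve-∀
  rearrange₂ : ∀ E K → K + (2 * suc E + 1) * K + 2 * (E * K) ≡ 4 * suc E * K
  rearrange₂ = solve-∀
  rearrange₃ : ∀ E K → 2 * (4 * suc E * (4 * suc E * K)) ≡ 32 * (suc E * suc E * K)
  rearrange₃ = solve-∀

-- The factor 32 comes from `coarse-bound`, each 6 from replacing `E + 1` by `6/ε`, and 4 from
-- replacing `K` by `4 ln n`.
factor : ℚ
factor = fromℕℚ 32 *ℚ (fromℕℚ 6 *ℚ fromℕℚ 6) *ℚ fromℕℚ 4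

scaled-bound : ∀ {ℓ} E K e L → ℓ ≤ 32 * (suc E * suc E * K) → 1/ℕ (suc E) ≤ℚ e → fromℕℚ (suc E) *ℚ e ≤ℚ fromℕℚ 6 →
               fromℕℚ K ≤ℚ fromℕℚ 4 *ℚ L → fromℕℚ ℓ ≤ℚ factor *ℚ (recip e *ℚ recip e) *ℚ L
scaled-bound {ℓ} E K e L ℓ≤ 1/E≤e Ee≤6 K≤4L = begin
  fromℕℚ ℓ                              ≤⟨ fromℕℚ-mono ℓ≤ ⟩
  fromℕℚ (32 * (suc E * suc E * K))     ≡⟨ fromℕℚ-* 32 (suc E * suc E * K) ⟩
  a *ℚ fromℕℚ (suc E * suc E * K)       ≡⟨ cong (a *ℚ_) (trans (fromℕℚ-* (suc E * suc E) K)
                                             (cong (_*ℚ fromℕℚ K) (fromℕℚ-* (suc E) (suc E)))) ⟩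
  a *ℚ (F *ℚ F *ℚ fromℕℚ K)             ≤⟨ ℚ.*-monoˡ-≤-nonNeg a (*-mono (0≤* 0≤F 0≤F) (ℚ.≤-trans (0≤fromℕℚ K) K≤4L)
                                             (*-mono 0≤F (ℚ.≤-trans 0≤F F≤) F≤ F≤) K≤4L) ⟩
  a *ℚ (b *ℚ r *ℚ (b *ℚ r) *ℚ (c *ℚ L)) ≡⟨ solve 5 (λ a b c r L → a :* (b :* r :* (b :* r) :* (c :* L))
                                             := a :* (b :* b) :* c :* (r :* r) :* L) refl a b c r L ⟩
  a *ℚ (b *ℚ b) *ℚ c *ℚ (r *ℚ r) *ℚ L   ∎
  where
  open ℚ.≤-Reasoning
  a b c F r : ℚ
  a = fromℕℚ 32
  b = fromℕℚ 6
  c = fromℕℚ 4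
  F = fromℕℚ (suc E)
  r = recip e
  0≤F : 0ℚ ≤ℚ F
  0≤F = 0≤fromℕℚ (suc E)
  0<e : 0ℚ <ℚ e
  0<e = ℚ.<-≤-trans (ℚ.positive⁻¹ _ {{ℚ.normalize-pos 1 (suc E)}}) 1/E≤e
  F≤ : F ≤ℚ b *ℚ r
  F≤ = subst (_≤ℚ b *ℚ r)
    (trans (ℚ.*-assoc F e r) (trans (cong (F *ℚ_) (recip-inverse 0<e)) (ℚ.*-identityʳ F)))
    (ℚ.*-monoʳ-≤-nonNeg r {{ℚ.nonNegative (0≤recip 0<e)}} Ee≤6)

component-upper : ∀ n ε (0<ε : fromℕ 0 <ᵣ ε) → ε <ᵣ fromℕ 1 → ∀ q → 2 ≤ n →
                  (fromℕ 1 +ᵣ ε) *ᵣ fromℕ n ≤ᵣ fromℕ q → ∀ {ℓ} → ℓ ≤ 𝓛 n q →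
                  fromℕ ℓ ≤ᵣ fromℚ factor *ᵣ (inv ε 0<ε *ᵣ inv ε 0<ε) *ᵣ ln n
component-upper n ε 0<ε ε<1 q 2≤n large {ℓ} ℓ≤𝓛 δ 0<δ =
  let E , i₀ , unit = unit-fraction ε 0<ε ε<1
      K , n≤2^K , 1≤K , K≤ = ln-log₂ n 2≤n
      -- A slack of 1 is affordable, because the spread condition compares `n` with `q + 1`.
      i₁ , large′ = large 1ℚ (ℚ.positive⁻¹ 1ℚ)
      spread′ = spread n q E (seq ε (i₀ ℕ.⊔ i₁)) (proj₁ (unit _ (ℕ.m≤m⊔n i₀ i₁))) (large′ _ (ℕ.m≤n⊔m i₀ i₁))
      ℓ≤ = ℕ.≤-trans ℓ≤𝓛 (ℕ.≤-trans (client-bound n q (suc E) K n≤2^K 1≤K spread′) (coarse-bound E K 1≤K))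
  in i₀ , λ i i₀≤i → weaken (scaled-bound E K (seq ε i) (seq (ln n) i) ℓ≤ (proj₁ (unit i i₀≤i)) (proj₂ (unit i i₀≤i)) (K≤ i))
  where
  weaken : ∀ {x y} → x ≤ℚ y → x ≤ℚ y +ℚ δ
  weaken {x} {y} x≤y = ℚ.≤-trans x≤y (subst (_≤ℚ y +ℚ δ) (ℚ.+-identityʳ y) (ℚ.+-monoʳ-≤ y (ℚ.<⇒≤ 0<δ)))

-- This is `𝓛 n q ≥ 2 (n - q - 1)` without subtraction, trivial for `n < q + 2`. Otherwise
-- `waiter-bound` applies with `b = n - q - 2`, and the hypothesis on `n` gives `b ≤ q`.
waiter-deficit : ∀ n q → n < 2 * suc q → 2 * n ≤ 𝓛 n q + 2 * suc q
waiter-deficit n q n< with q + 2 ℕ.≤? n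
... | no  big = ℕ.≤-trans (ℕ.*-monoʳ-≤ 2 (ℕ.≤-pred (subst (n <_) (ℕ.+-comm q 2) (ℕ.≰⇒> big)))) (ℕ.m≤n+m _ (𝓛 n q))
... | yes fit with n ∸ (q + 2) in eq
...   | b = subst (λ n → 2 * n ≤ 𝓛 n q + 2 * suc q) n≡
  (ℕ.≤-trans (ℕ.≤-reflexive (rearrange₁ q b)) (ℕ.+-monoˡ-≤ (2 * suc q) (waiter-bound q b b≤q)))
  where
  rearrange₁ : ∀ q b → 2 * (q + b + 2) ≡ 2 * suc b + 2 * suc q
  rearrange₁ = solve-∀
  rearrange₂ : ∀ q b → q + b + 2 ≡ q + 2 + b
  rearrange₂ = solve-∀
  rearrange₃ : ∀ q → 2 * suc q ≡ q + 2 + q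
  rearrange₃ = solve-∀
  n≡ : q + b + 2 ≡ n
  n≡ = trans (rearrange₂ q b) (trans (cong (q + 2 +_) (sym eq)) (ℕ.m+[n∸m]≡n fit))
  b≤q : b ≤ q
  b≤q = ℕ.+-cancelˡ-≤ (q + 2) b q (subst₂ _≤_ (trans (sym n≡) (rearrange₂ q b)) (rearrange₃ q) (ℕ.<⇒≤ n<))

component-lower : ∀ n (ε : ℝ) q → fromℕ q ≤ᵣ (fromℕ 1 -ᵣ ε) *ᵣ fromℕ n → ∀ {ℓ} → 𝓛 n q ≤ ℓ →
                  fromℕ n ⊓ᵣ (fromℕ 2 *ᵣ ε *ᵣ fromℕ n -ᵣ fromℕ 2) ≤ᵣ fromℕ ℓ
component-lower n ε q small {ℓ} 𝓛≤ℓ δ 0<δ with 2 * suc q ℕ.≤? n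
... | yes le = 0 , λ i _ → ℚ.≤-trans (ℚ.p⊓q≤p (fromℕℚ n) _) (ℚ.≤-trans (fromℕℚ-mono (ℕ.≤-trans (waiter-spanning n q le) 𝓛≤ℓ))
        (subst (_≤ℚ fromℕℚ ℓ +ℚ δ) (ℚ.+-identityʳ (fromℕℚ ℓ)) (ℚ.+-monoʳ-≤ (fromℕℚ ℓ) (ℚ.<⇒≤ 0<δ))))
-- Half of `δ`, as the inequality for `q` is doubled in `bound`.
... | no  gt with small (δ *ℚ ½) (half-pos 0<δ)
...   | N , small′ = N , λ i N≤i → ℚ.≤-trans (ℚ.p⊓q≤q (fromℕℚ n) _) (bound (seq ε i) (small′ i N≤i))
  where
  Q M L : ℚ
  Q = fromℕℚ q
  M = fromℕℚ n
  L = fromℕℚ ℓ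
  deficit : fromℕℚ 2 *ℚ M ≤ℚ L +ℚ fromℕℚ 2 *ℚ (1ℚ +ℚ Q)
  deficit = subst₂ _≤ℚ_ (fromℕℚ-* 2 n)
    (trans (fromℕℚ-+ ℓ (2 * suc q)) (cong (L +ℚ_) (trans (fromℕℚ-* 2 (suc q)) (cong (fromℕℚ 2 *ℚ_) (fromℕℚ-+ 1 q)))))
    (fromℕℚ-mono (ℕ.≤-trans (waiter-deficit n q (ℕ.≰⇒> gt)) (ℕ.+-monoˡ-≤ (2 * suc q) 𝓛≤ℓ)))
  bound : ∀ e → Q ≤ℚ (1ℚ -ℚ e) *ℚ M +ℚ δ *ℚ ½ → fromℕℚ 2 *ℚ e *ℚ M -ℚ fromℕℚ 2 ≤ℚ L +ℚ δ
  bound e le = begin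
    two *ℚ e *ℚ M -ℚ two
      ≡⟨ solve 3 (λ e m q → con two :* e :* m :- con two := (con two :* e :* m :- con two :- con two :* q) :+ con two :* q) refl e M Q ⟩
    (two *ℚ e *ℚ M -ℚ two -ℚ two *ℚ Q) +ℚ two *ℚ Q
      ≤⟨ ℚ.+-monoʳ-≤ (two *ℚ e *ℚ M -ℚ two -ℚ two *ℚ Q) (ℚ.*-monoˡ-≤-nonNeg two le) ⟩
    (two *ℚ e *ℚ M -ℚ two -ℚ two *ℚ Q) +ℚ two *ℚ ((1ℚ -ℚ e) *ℚ M +ℚ δ *ℚ ½)
      ≡⟨ solve 4 (λ e m q d → (con two :* e :* m :- con two :- con two :* q) :+ con two :* ((con 1ℚ :- e) :* m :+ d :* con ½)
                            := con two :* m :+ (d :- con two :* (con 1ℚ :+ q))) refl e M Q δ ⟩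
    two *ℚ M +ℚ (δ -ℚ two *ℚ (1ℚ +ℚ Q))
      ≤⟨ ℚ.+-monoˡ-≤ (δ -ℚ two *ℚ (1ℚ +ℚ Q)) deficit ⟩
    L +ℚ two *ℚ (1ℚ +ℚ Q) +ℚ (δ -ℚ two *ℚ (1ℚ +ℚ Q))
      ≡⟨ solve 3 (λ l q d → l :+ con two :* (con 1ℚ :+ q) :+ (d :- con two :* (con 1ℚ :+ q)) := l :+ d) refl L Q δ ⟩
    L +ℚ δ ∎
    where
    open ℚ.≤-Reasoning
    two : ℚ
    two = fromℕℚ 2

theorem1p1 : ∃ λ (c : ℝ) → ∃ λ (n₀ : ℕ) →
    (n : ℕ) → n₀ ≤ n →
    (ε : ℝ) (0<ε : fromℕ 0 <ᵣ ε) → ε <ᵣ fromℕ 1 →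
    (q : ℕ) → 1 ≤ q →
    ( (fromℕ 1 +ᵣ ε) *ᵣ fromℕ n ≤ᵣ fromℕ q →
    ClientCanEnsure n q (λ ℓ → fromℕ ℓ ≤ᵣ c *ᵣ (inv ε 0<ε *ᵣ inv ε 0<ε) *ᵣ ln n)
    × fromℕ (𝓛 n q) ≤ᵣ c *ᵣ (inv ε 0<ε *ᵣ inv ε 0<ε) *ᵣ ln n )
    × ( fromℕ q ≤ᵣ (fromℕ 1 -ᵣ ε) *ᵣ fromℕ n →
    WaiterCanEnsure n q (λ ℓ → fromℕ n ⊓ᵣ (fromℕ 2 *ᵣ ε *ᵣ fromℕ n -ᵣ fromℕ 2) ≤ᵣ fromℕ ℓ)
    × fromℕ n ⊓ᵣ (fromℕ 2 *ᵣ ε *ᵣ fromℕ n -ᵣ fromℕ 2) ≤ᵣ fromℕ (𝓛 n q) )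
-- The threshold 2 serves `ln-log₂`: at `n = 1` the logarithm vanishes and cannot dominate `K ≥ 1`.
theorem1p1 = fromℚ factor , 2 , λ n 2≤n ε 0<ε ε<1 q _ →
    (λ large → (client* , λ σ → component-upper n ε 0<ε ε<1 q 2≤n large (client-optimal σ))
             , component-upper n ε 0<ε ε<1 q 2≤n large ℕ.≤-refl)
  , (λ small → (waiter* , λ τ → component-lower n ε q small (waiter-optimal τ))
             , component-lower n ε q small ℕ.≤-refl)
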